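{- Let $\mu\in(0,1)$ be a constant. Suppose there exists a data structure that, given any straight-line grammar (SLG) $G$ representing a string $T\in\Sigma^{N}$, where $\Sigma=\{1,\ldots,\sigma\}$ and $\sigma=\Omega(N^{\mu/3})$, computes an $\lfloor N^{1-\mu}\rfloor$-additive approximation of a given two-sided rank query on $T$ in $O(\log^{O(1)}N)$ time, and takes $O(|G|\log^{O(1)}N)$ time to construct. Then the Boolean matrix product of any two $n\times n$ Boolean matrices can be computed in $O(n^2\log^{O(1)}n)$ time.
   Context: **Model and asymptotics.** Running times are in the standard word RAM model with machine words of $\Theta(\log n)$ bits ($n$ the input-size parameter), where standard arithmetic and bitwise operations take $O(1)$ time. $\log^{O(1)}N$ means $(\log N)^c$ for some constant $c$. The condition $\sigma=\Omega(N^{\mu/3})$ restricts the inputs that must be handled to those with $\sigma\ge\kappa N^{\mu/3}$ for a fixed constant $\kappa>0$. **Straight-line grammars.** An SLG is a context-free grammar $G=(V,\Sigma,R,S)$ (nonterminals $V$, terminals $\Sigma$, $V\cap\Sigma=\emptyset$, rules $R\subseteq V\times(V\cup\Sigma)^*$, start symbol $S\in V$) such that each $N\in V$ has exactly one rule $(N,\gamma)\in R$, whose right-hand side $\gamma$ is denoted $\mathrm{rhs}_G(N)$, and there is an ordering $N_1,\ldots,N_{|V|}$ of $V$ with $\mathrm{rhs}_G(N_i)\in(\{N_{i+1},\ldots,N_{|V|}\}\cup\Sigma)^*$ for all $i$. Hence $G$ generates (represents) exactly one string. The size of $G$ is $|G|=\sum_{N\in V}\max(|\mathrm{rhs}_G(N)|,1)$.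 **Two-sided rank query.** Strings are indexed from $1$. For $T\in\Sigma^N$, $b,e\in\{0,\ldots,N\}$ and $c\in\Sigma$, the query asks for $\mathrm{rank}_T(b,e,c)=|\{i: b<i\le e,\ T[i]=c\}|$. **Additive approximation.** For an integer $k\ge1$, an integer $x$ is a $k$-additive approximation of $\mathrm{rank}_T(b,e,c)$ if $\mathrm{rank}_T(b,e,c)-k<x<\mathrm{rank}_T(b,e,c)+k$. **Boolean matrix product.** For $A,B\in\{0,1\}^{n\times n}$, $(AB)[i,j]=\bigvee_{k=1}^n A[i,k]\wedge B[k,j]$. -}

module Defs where

open import Data.Bool.ListAction using (any)
open import Data.Bool.Base using (Bool; true; false; if_then_else_; _∧_; _∨_; _xor_)
open import Data.Empty using (⊥)
open import Data.Fin.Base as Fin using (Fin; toℕ; fromℕ<; remQuot)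
open import Data.Fin.Permutation using (Permutation′; _⟨$⟩ʳ_)
import Data.Fin.Properties as Finₚ
open import Data.Integer.Base as ℤ using (ℤ; _⊖_)
open import Data.List.Base using (List; []; _∷_; _++_; allFin; concatMap; filter; length; map)
open import Data.List.Membership.Propositional using (_∈_)
open import Data.Nat.Base
open import Data.Nat.ListAction using (sum)
open import Data.Nat.Logarithm using (⌊log₂_⌋)
open import Data.Nat.Properties using (_≤?_; _<?_; m^n≢0)
open import Data.Nat.DivMod using (_/_; _%_)
open import Data.Product.Base using (∃; ∃-syntax; _×_; _,_; proj₁; proj₂)
open import Data.Rational.Base as ℚ using (ℚ; 0ℚ; 1ℚ; ↥_; ↧ₙ_)
import Data.Rational.Properties as ℚₚ
open import Data.Sum.Base as Sum using (_⊎_; inj₁; inj₂; [_,_]′)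
open import Data.Vec.Base using (Vec; lookup; toList)
open import Relation.Binary.Construct.Closure.ReflexiveTransitive using (Star)
open import Relation.Binary.PropositionalEquality using (_≡_; _≢_; refl; sym; trans; cong; subst; subst₂)
open import Relation.Nullary using (¬_; yes; no; _×-dec_)

-- Two-sided, located Dedekind cuts.
record ℝ : Set₁ where
  field
    Below           : ℚ → Set          -- the rationals q with q < x
    Above           : ℚ → Set          -- the rationals q with x < q
    below-inhabited : ∃ Below
    above-inhabited : ∃ Above
    below-closed    : ∀ {q r} → q ℚ.< r → Below r → Below q
    above-closed    : ∀ {q r} → q ℚ.< r → Above q → Above r
    below-open      : ∀ {q} → Below q → ∃[ r ] (q ℚ.< r × Below r)
    above-open      : ∀ {q} → Above q → ∃[ r ] (r ℚ.< q × Above r)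
    disjoint        : ∀ {q} → Below q → Above q → ⊥
    located         : ∀ {q r} → q ℚ.< r → Below q ⊎ Above r

open ℝ

infix 4 _<ʳ_ _ʳ<_

_<ʳ_ : ℚ → ℝ → Set
q <ʳ x = Below x q

_ʳ<_ : ℝ → ℚ → Set
x ʳ< q = Above x q

private
  flip : ℚ → ℚ
  flip q = 1ℚ ℚ.- q

  flip-anti : ∀ {q r} → q ℚ.< r → flip r ℚ.< flip q
  flip-anti q<r = ℚₚ.+-monoʳ-< 1ℚ (ℚₚ.neg-antimono-< q<r)

  flip-flip : ∀ q → flip (flip q) ≡ q
  flip-flip q = trans
    (cong (1ℚ ℚ.+_) (trans (ℚₚ.neg-distrib-+ 1ℚ (ℚ.- q)) (cong (ℚ.- 1ℚ ℚ.+_) (neg-neg q))))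
    (trans (sym (ℚₚ.+-assoc 1ℚ (ℚ.- 1ℚ) q))
      (trans (cong (ℚ._+ q) (ℚₚ.+-inverseʳ 1ℚ)) (ℚₚ.+-identityˡ q)))
    where
    open import Algebra.Properties.Group ℚₚ.+-0-group using (⁻¹-involutive)
    neg-neg : ∀ p → ℚ.- (ℚ.- p) ≡ p
    neg-neg = ⁻¹-involutive

  three : ℚ
  three = (ℤ.+ 3) ℚ./ 1

  third : ℚ
  third = (ℤ.+ 1) ℚ./ 3

  triple-third : ∀ q → three ℚ.* (third ℚ.* q) ≡ q
  triple-third q = trans (sym (ℚₚ.*-assoc three third q)) (ℚₚ.*-identityˡ q)

  third-triple : ∀ q → third ℚ.* (three ℚ.* q) ≡ q
  third-triple q = trans (sym (ℚₚ.*-assoc third three q)) (ℚₚ.*-identityˡ q)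

  triple-mono : ∀ {q r} → q ℚ.< r → three ℚ.* q ℚ.< three ℚ.* r
  triple-mono = ℚₚ.*-monoʳ-<-pos three

  third-mono : ∀ {q r} → q ℚ.< r → third ℚ.* q ℚ.< third ℚ.* r
  third-mono = ℚₚ.*-monoʳ-<-pos third

-- q < 1 - x iff x < 1 - q
1-_ : ℝ → ℝ
1- x = record
  { Below           = λ q → Above x (flip q)
  ; Above           = λ q → Below x (flip q)
  ; below-inhabited = let (q , p) = above-inhabited x in flip q , subst (Above x) (sym (flip-flip q)) p
  ; above-inhabited = let (q , p) = below-inhabited x in flip q , subst (Below x) (sym (flip-flip q)) p
  ; below-closed    = λ q<r → above-closed x (flip-anti q<r)
  ; above-closed    = λ q<r → below-closed x (flip-anti q<r)
  ; below-open      = λ {q} p → let (r , r<q , a) = above-open x p in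
      flip r , subst (ℚ._< flip r) (flip-flip q) (flip-anti r<q) , subst (Above x) (sym (flip-flip r)) a
  ; above-open      = λ {q} p → let (r , q<r , b) = below-open x p in
      flip r , subst (flip r ℚ.<_) (flip-flip q) (flip-anti q<r) , subst (Below x) (sym (flip-flip r)) b
  ; disjoint        = λ a b → disjoint x b a
  ; located         = λ q<r → Sum.swap (located x (flip-anti q<r))
  }

-- q < x / 3 iff 3q < x
_/3 : ℝ → ℝ
x /3 = record
  { Below           = λ q → Below x (three ℚ.* q)
  ; Above           = λ q → Above x (three ℚ.* q)
  ; below-inhabited = let (q , p) = below-inhabited x in third ℚ.* q , subst (Below x) (sym (triple-third q)) p
  ; above-inhabited = let (q , p) = above-inhabited x in third ℚ.* q , subst (Above x) (sym (triple-third q)) p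
  ; below-closed    = λ q<r → below-closed x (triple-mono q<r)
  ; above-closed    = λ q<r → above-closed x (triple-mono q<r)
  ; below-open      = λ {q} p → let (r , q<r , b) = below-open x p in
      third ℚ.* r , subst (ℚ._< third ℚ.* r) (third-triple q) (third-mono q<r) , subst (Below x) (sym (triple-third r)) b
  ; above-open      = λ {q} p → let (r , r<q , a) = above-open x p in
      third ℚ.* r , subst (third ℚ.* r ℚ.<_) (third-triple q) (third-mono r<q) , subst (Above x) (sym (triple-third r)) a
  ; disjoint        = disjoint x
  ; located         = λ q<r → located x (triple-mono q<r)
  }

-- Below, N ≥ 1 and the real exponent x is positive: N^x is the supremum of
-- N^e over rationals 0 ≤ e < x, and the infimum of N^e over rationals e > x.
-- A comparison with N^e, e = p/q, is cleared of roots by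
-- raising both sides to the power q.

-- k ≤ N^x
_≤[_^_] : ℕ → ℕ → ℝ → Set
k ≤[ N ^ x ] = ∀ e → 0ℚ ℚ.≤ e → x ʳ< e → k ^ ↧ₙ e ≤ N ^ ℤ.∣ ↥ e ∣

-- N^x < k
[_^_]<_ : ℕ → ℝ → ℕ → Set
[ N ^ x ]< k = ∃[ e ] (0ℚ ℚ.≤ e × x ʳ< e × N ^ ℤ.∣ ↥ e ∣ < k ^ ↧ₙ e)

-- K = ⌊N^x⌋
_≡⌊_^_⌋ : ℕ → ℕ → ℝ → Set
K ≡⌊ N ^ x ⌋ = K ≤[ N ^ x ] × [ N ^ x ]< suc K

-- κ · N^x ≤ k, for κ > 0: that is, r · N^e ≤ k for all rationals 0 ≤ r < κ and 0 ≤ e < x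
_·[_^_]≤_ : ℝ → ℕ → ℝ → ℕ → Set
κ ·[ N ^ x ]≤ k = ∀ r e → 0ℚ ℚ.≤ r → r <ʳ κ → 0ℚ ℚ.≤ e → e <ʳ x →
  ℤ.∣ ↥ r ∣ ^ ↧ₙ e * N ^ ℤ.∣ ↥ e ∣ ≤ (k * ↧ₙ r) ^ ↧ₙ e

-- The bit length; it stands for log N in asymptotic bounds, so that the bounds
-- also make sense for N = 1.
lg : ℕ → ℕ
lg N = 1 + ⌊log₂ N ⌋

-- A word RAM with programs in structured form.  A program uses finitely many
-- registers and finitely many random-access arrays (memory segments), named by
-- numbers; each array has one cell for every word, and every step costs
-- 1.  All values a program computes are reduced modulo 2^w, w being the word length.

Register Array : Set
Register = ℕ
Array    = ℕ

data Op : Set where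
  add sub mul div rem and or xor shl shr lt eq : Op

infixr 5 _⨾_

data Program : Set where
  const : Register → ℕ → Program
  op    : Register → Op → Register → Register → Program
  load  : Register → Array → Register → Program          -- r ← a[i]
  store : Array → Register → Register → Program          -- a[i] ← r
  _⨾_   : Program → Program → Program
  ifnz  : Register → Program → Program → Program
  while : Register → Program → Program                   -- repeat as long as r ≠ 0

record State : Set where
  constructor ⟨_,_⟩
  field
    reg : Register → ℕ
    mem : Array → ℕ → ℕ

open State public

setReg : State → Register → ℕ → State
setReg s r x = ⟨ (λ q → if q ≡ᵇ r then x else reg s q) , mem s ⟩

setMem : State → Array → ℕ → ℕ → State
setMem s a i x = ⟨ reg s , (λ b j → if (b ≡ᵇ a) ∧ (j ≡ᵇ i) then x else mem s b j) ⟩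

fromBool : Bool → ℕ
fromBool false = 0
fromBool true  = 1

module WordRAM (w : ℕ) where

  word : ℕ → ℕ
  word x = (x % 2 ^ w) {{m^n≢0 2 w}}

  bitwise : (Bool → Bool → Bool) → ℕ → ℕ → ℕ → ℕ
  bitwise f zero    x y = 0
  bitwise f (suc k) x y = fromBool (f (x % 2 ≡ᵇ 1) (y % 2 ≡ᵇ 1)) + 2 * bitwise f k (x / 2) (y / 2)

  -- Division by zero yields 0.
  eval : Op → ℕ → ℕ → ℕ
  eval add x y       = word (x + y)
  eval sub x y       = word (x + (2 ^ w ∸ y))
  eval mul x y       = word (x * y)
  eval div x zero    = 0
  eval div x (suc y) = word (x / suc y)
  eval rem x zero    = 0
  eval rem x (suc y) = word (x % suc y)
  eval and x y       = bitwise _∧_ w x y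
  eval or  x y       = bitwise _∨_ w x y
  eval xor x y       = bitwise _xor_ w x y
  eval shl x y       = word (x * 2 ^ y)
  eval shr x y       = word ((x / 2 ^ y) {{m^n≢0 2 y}})
  eval lt  x y       = word (fromBool (x <ᵇ y))
  eval eq  x y       = word (fromBool (x ≡ᵇ y))

  -- Run P s t s′: started in state s, P halts after t steps in state s′.
  data Run : Program → State → ℕ → State → Set where
    run-const  : ∀ {s r x} → Run (const r x) s 1 (setReg s r (word x))
    run-op     : ∀ {s r o p q} → Run (op r o p q) s 1 (setReg s r (eval o (reg s p) (reg s q)))
    run-load   : ∀ {s r a i} → Run (load r a i) s 1 (setReg s r (mem s a (reg s i)))
    run-store  : ∀ {s a i r} → Run (store a i r) s 1 (setMem s a (reg s i) (reg s r))
    run-seq    : ∀ {P Q s s′ s″ t t′} → Run P s t s′ → Run Q s′ t′ s″ → Run (P ⨾ Q) s (t + t′) s″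
    run-then   : ∀ {r P Q s s′ t} → reg s r ≢ 0 → Run P s t s′ → Run (ifnz r P Q) s (1 + t) s′
    run-else   : ∀ {r P Q s s′ t} → reg s r ≡ 0 → Run Q s t s′ → Run (ifnz r P Q) s (1 + t) s′
    run-done   : ∀ {r P s} → reg s r ≡ 0 → Run (while r P) s 1 s
    run-repeat : ∀ {r P s s′ s″ t t′} → reg s r ≢ 0 → Run P s t s′ → Run (while r P) s′ t′ s″ →
                 Run (while r P) s (1 + t + t′) s″

open WordRAM public using (Run)

-- Initial contents given by a list; everything beyond its end is zero.
cells : List ℕ → ℕ → ℕ
cells []       _       = 0
cells (x ∷ xs) zero    = x
cells (x ∷ xs) (suc i) = cells xs i

arrays : List (ℕ → ℕ) → Array → ℕ → ℕ
arrays []       _       = λ _ → 0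
arrays (f ∷ fs) zero    = f
arrays (f ∷ fs) (suc a) = arrays fs a

-- Nonterminals are Fin nonterminals; the letter a of {1,…,σ} is the element a - 1 of Fin σ.
record SLG (σ : ℕ) : Set where
  field
    nonterminals : ℕ

  Nonterminal : Set
  Nonterminal = Fin nonterminals

  Symbol : Set
  Symbol = Nonterminal ⊎ Fin σ

  field
    rhs     : Nonterminal → List Symbol
    start   : Nonterminal
    order   : Permutation′ nonterminals   -- the position of each nonterminal in the ordering
    acyclic : ∀ A B → inj₁ B ∈ rhs A → order ⟨$⟩ʳ A Fin.< order ⟨$⟩ʳ B

  size : ℕ
  size = sum (map (λ A → length (rhs A) ⊔ 1) (allFin nonterminals))

  data _⇒_ : List Symbol → List Symbol → Set where
    derive : ∀ α A β → (α ++ inj₁ A ∷ β) ⇒ (α ++ rhs A ++ β)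

  Represents : ∀ {N} → Vec (Fin σ) N → Set
  Represents T = Star _⇒_ (inj₁ start ∷ []) (map inj₂ (toList T))

  -- Letters are coded by 1,…,σ and nonterminals by σ+1,…,σ+nonterminals.
  code : Symbol → ℕ
  code = [ (λ A → suc (σ + toℕ A)) , (λ a → suc (toℕ a)) ]′

  -- Input of a grammar: array 0 lists, for each nonterminal in turn, the length
  -- of its right-hand side followed by the symbols of that right-hand side.
  -- The order witness is not part of the input.
  input : State
  input = ⟨ cells (nonterminals ∷ σ ∷ code (inj₁ start) ∷ [])
          , arrays (cells (concatMap (λ A → length (rhs A) ∷ map code (rhs A)) (allFin nonterminals)) ∷ []) ⟩

rank : ∀ {σ N} → Vec (Fin σ) N → ℕ → ℕ → Fin σ → ℕ
rank {N = N} T b e c =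
  length (filter (λ i → b <? suc (toℕ i) ×-dec suc (toℕ i) ≤? e ×-dec lookup T i Finₚ.≟ c) (allFin N))

IsAdditiveApproximation : ℕ → ℤ → ℕ → Set
IsAdditiveApproximation k x r = (ℤ.+ r ℤ.- ℤ.+ k) ℤ.< x × x ℤ.< (ℤ.+ r ℤ.+ ℤ.+ k)

-- A query is passed in registers 0, 1, 2; everything else is left as it is.
ask : State → ℕ → ℕ → ∀ {σ} → Fin σ → State
ask s b e c = setReg (setReg (setReg s 0 b) 1 e) 2 (suc (toℕ c))

-- A possibly negative answer is returned as a difference of two words.
answer : State → ℤ
answer s = reg s 0 ⊖ reg s 1

-- States of the data structure after its construction for G and any sequence of
-- queries on a string of length N; queries are allowed to modify the structure.
data Reachable (w : ℕ) (construct query : Program) {σ : ℕ} (G : SLG σ) (N : ℕ) : State → Set where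
  constructed : ∀ {t s} → Run w construct (SLG.input G) t s → Reachable w construct query G N s
  queried     : ∀ {s t s′} b e c → b ≤ N → e ≤ N → Reachable w construct query G N s →
                Run w query (ask s b e {σ} c) t s′ → Reachable w construct query G N s′

-- Words have Θ(log n) bits where n = N + σ + |G|, so that every number in the
-- input and every position of the string fits in a word for every grammar.
record ApproximateRankStructure (μ κ : ℝ) : Set where
  field
    construct query : Program
    wordFactor      : ℕ
    wordFactor≥1    : 1 ≤ wordFactor
    C₁ d₁ C₂ d₂     : ℕ

  wordLength : ∀ {σ} → SLG σ → ℕ → ℕ
  wordLength {σ} G N = wordFactor * lg (N + σ + SLG.size G)

  field
    construction : ∀ {σ N} (G : SLG σ) (T : Vec (Fin σ) N) → 1 ≤ N → SLG.Represents G T →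
      κ ·[ N ^ μ /3 ]≤ σ →
      ∃[ t ] ∃[ s ] (Run (wordLength G N) construct (SLG.input G) t s
                     × t ≤ C₁ * (SLG.size G * lg N ^ d₁))

    querying : ∀ {σ N} (G : SLG σ) (T : Vec (Fin σ) N) → 1 ≤ N → SLG.Represents G T →
      κ ·[ N ^ μ /3 ]≤ σ →
      ∀ s → Reachable (wordLength G N) construct query G N s →
      ∀ b e c → b ≤ N → e ≤ N →
      ∃[ t ] ∃[ s′ ] (Run (wordLength G N) query (ask s b e c) t s′
                      × t ≤ C₂ * lg N ^ d₂
                      × (∀ K → K ≡⌊ N ^ 1- μ ⌋ → IsAdditiveApproximation K (answer s′) (rank T b e c)))

BoolMatrix : ℕ → Set
BoolMatrix n = Fin n → Fin n → Bool

_⊗_ : ∀ {n} → BoolMatrix n → BoolMatrix n → BoolMatrix n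
(A ⊗ B) i j = any (λ k → A i k ∧ B k j) (allFin _)

rowMajor : ∀ {n} → BoolMatrix n → ℕ → ℕ
rowMajor {n} M k with k <? n * n
... | yes k<n² = let (i , j) = remQuot {n} n (fromℕ< k<n²) in fromBool (M i j)
... | no  _    = 0

matrixInput : ∀ {n} → BoolMatrix n → BoolMatrix n → State
matrixInput {n} A B = ⟨ cells (n ∷ []) , arrays (rowMajor A ∷ rowMajor B ∷ []) ⟩

-- The product is to be written in row-major order to array 2.
record FastBooleanMatrixProduct : Set where
  field
    program      : Program
    wordFactor   : ℕ
    wordFactor≥1 : 1 ≤ wordFactor
    C d          : ℕ
    multiplies   : ∀ n → 1 ≤ n → (A B : BoolMatrix n) →
      ∃[ t ] ∃[ s ] (Run (wordFactor * lg n) program (matrixInput A B) t s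
                     × t ≤ C * (n ^ 2 * lg n ^ d)
                     × (∀ k → k < n * n → mem s 2 k ≡ rowMajor (A ⊗ B) k))

{-# OPTIONS --safe #-}
-- Let D = n + 1, the extra index being a dummy, and pad both matrices.  Write the row k of B as the
-- word of the letters j with B k j, the row i of A as the concatenation of the words of the k with
-- A i k (all padded to fixed lengths by dummies), repeat the latter word D^c times, and concatenate
-- over all i.  This is a grammar of size O(n²) in which the letter j occurs in block i either never
-- or at least D^c times.  If 1/q < μ and c is chosen such that the text has length N = D^(4q), then
-- ⌊N^(1-μ)⌋ ≤ D^(4q-4) while D^c = D^(4q-3) is at least twice as large, so that an approximate rank
-- decides an entry of A B.  That the floor need not be computable does no harm: an equation between
-- numbers is stable under double negation, and the floor exists up to double negation.
module Submission where

open import Data.Bool.Base using (Bool; true; false; if_then_else_; T; _∧_; _∨_; _xor_)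
open import Data.Bool.Properties using (T-≡; T-∧; T-∨)
open import Data.Fin.Base as Fin using (Fin; zero; suc; toℕ; fromℕ; fromℕ<; inject₁; inject≤; combine; remQuot; opposite; _↑ˡ_; _↑ʳ_)
open import Data.Fin.Patterns
open import Data.Fin.Permutation using (reverse)
import Data.Fin.Properties as Finₚ
open import Data.Integer.Base as ℤ using (ℤ; _⊖_; +≤+; +<+)
import Data.Integer.Properties as ℤₚ
open import Data.Integer.Tactic.RingSolver using (solve-∀)
open import Data.List.Base as List using (List; []; _∷_; _++_; allFin; concat; concatMap; filter; length; map; tabulate)
open import Data.List.Membership.Propositional using (_∈_; find; lose)
open import Data.List.Membership.Propositional.Properties using (∈-allFin; ∈-filter⁺; ∈-tabulate⁻)
open import Data.List.Properties using (++-assoc; ++-identityʳ; filter-none; length-++; length-map; length-tabulate; map-++; map-tabulate; tabulate-cong)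
import Data.List.Relation.Unary.All as All
import Data.List.Relation.Unary.Any as Any
open import Data.List.Relation.Unary.Any.Properties using (any⁺; any⁻; lookup-index)
open import Data.Nat.Base
import Data.Nat.Coprimality as Coprime
open import Data.Nat.Divisibility using (n∣m*n)
open import Data.Nat.DivMod using (_/_; _%_; +-distrib-/-∣ˡ; /-monoˡ-≤; [m+kn]%n≡m%n; [m+n]%n≡m%n; m%n<n; m%n≤m; m*n/n≡m; m/n≤m; m<n*o⇒m/o<n; m<n⇒m%n≡m; m<n⇒m/n≡0; m≡m%n+[m/n]*n)
open import Data.Nat.ListAction using (sum)
open import Data.Nat.Logarithm using (⌊log₂_⌋; ⌊log₂[2^n]⌋≡n; ⌊log₂⌊n/2⌋⌋≡⌊log₂n⌋∸1; ⌊log₂⌋-mono-≤)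
open import Data.Nat.Properties
open import Data.Product.Base using (∃-syntax; _×_; _,_; proj₁; proj₂; uncurry)
open import Data.Rational.Base as ℚ using (ℚ; mkℚ; 0ℚ; 1ℚ; ↥_; ↧ₙ_; *<*; *≤*)
import Data.Rational.Properties as ℚₚ
import Data.Rational.Unnormalised.Base as ℚᵘ
import Data.Rational.Unnormalised.Properties as ℚᵘₚ
open import Data.Sum.Base using (_⊎_; inj₁; inj₂)
open import Data.Unit.Base using (⊤; tt)
open import Data.Vec.Base as Vec using (Vec; []; _∷_; lookup; _[_]≔_)
open import Data.Vec.Properties using (lookup∘tabulate; lookup∘updateAt; lookup∘updateAt′; []≔-idempotent)
open import Function.Base using (_∘_; id)
open import Function.Bundles using (Equivalence)
open import Relation.Binary.Construct.Closure.ReflexiveTransitive using (Star; ε; _◅_; _◅◅_; gmap)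
open import Relation.Binary.Definitions using (tri<; tri≈; tri>)
open import Relation.Binary.PropositionalEquality
open import Relation.Nullary using (¬_; Dec; yes; no; contradiction)
open import Relation.Nullary.Decidable using (decidable-stable)
open import Relation.Unary using (Decidable)
open import Algebra.Properties.CommutativeSemigroup *-commutativeSemigroup using (interchange)
open import Defs

-- The 4 in the exponent of N counts levels. Two levels build the rows of `B` and of the product,
-- one concatenates over all `i`, and one of the repeating levels lifts the count to at least twice
-- the error bound, because D ≥ 2. The text is thus D^4 times longer than that bound, and this gap
-- has to be N^(1/q). Every level has D objects of D parts each, so that each cell of the encoded
-- grammar is a closed formula in its address and costs constant time, by division with remainder.
-- The data structure is known only through two programs. They may use any registers and arrays, may
-- alter the structure while answering, and compute modulo a power of two that depends on N, σ and
-- the size of the grammar. They are therefore moved to fresh registers and arrays, and the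
-- surrounding program has to run with exactly their word length. To control that length, the
-- alphabet is enlarged by letters that never occur, until σ is a power of two dominating N and the
-- size of the grammar. This also meets the lower bound on σ for every κ, and lengthens the words by
-- a constant factor only.

-- Register updates

≡ᵇ-refl : ∀ m → (m ≡ᵇ m) ≡ true
≡ᵇ-refl zero    = refl
≡ᵇ-refl (suc m) = ≡ᵇ-refl m

≢⇒≡ᵇ : ∀ {m n} → m ≢ n → (m ≡ᵇ n) ≡ false
≢⇒≡ᵇ {zero}  {zero}  m≢n = contradiction refl m≢n
≢⇒≡ᵇ {zero}  {suc n} m≢n = refl
≢⇒≡ᵇ {suc m} {zero}  m≢n = refl
≢⇒≡ᵇ {suc m} {suc n} m≢n = ≢⇒≡ᵇ (m≢n ∘ cong suc)

+-≡ᵇ : ∀ k m n → (k + m ≡ᵇ k + n) ≡ (m ≡ᵇ n)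
+-≡ᵇ zero    m n = refl
+-≡ᵇ (suc k) m n = +-≡ᵇ k m n

setReg-same : ∀ s r x → reg (setReg s r x) r ≡ x
setReg-same s r x rewrite ≡ᵇ-refl r = refl

setReg-other : ∀ s {r q} x → q ≢ r → reg (setReg s r x) q ≡ reg s q
setReg-other s x q≢r rewrite ≢⇒≡ᵇ q≢r = refl

-- Relocation of programs

-- The construction and query programs may name any registers and arrays. Shifting their names
-- upward reserves the low ones for the calling program.
offset : ℕ → ℕ → Program → Program
offset k l (const r x)  = const (k + r) x
offset k l (op r o p q) = op (k + r) o (k + p) (k + q)
offset k l (load r a i) = load (k + r) (l + a) (k + i)
offset k l (store a i r) = store (l + a) (k + i) (k + r)
offset k l (P ⨾ Q)      = offset k l P ⨾ offset k l Q
offset k l (ifnz r P Q) = ifnz (k + r) (offset k l P) (offset k l Q)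
offset k l (while r P)  = while (k + r) (offset k l P)

record Embeds (k l : ℕ) (ŝ s : State) : Set where
  field
    reg↑ : ∀ r → reg s (k + r) ≡ reg ŝ r
    mem↑ : ∀ a i → mem s (l + a) i ≡ mem ŝ a i
open Embeds

record SameBelow (k l : ℕ) (s s′ : State) : Set where
  field
    reg↓ : ∀ r → r < k → reg s′ r ≡ reg s r
    mem↓ : ∀ a → a < l → ∀ i → mem s′ a i ≡ mem s a i
open SameBelow

module _ {k l : ℕ} where

  setReg-embeds : ∀ {ŝ s r x y} → Embeds k l ŝ s → y ≡ x → Embeds k l (setReg ŝ r x) (setReg s (k + r) y)
  setReg-embeds {r = r} {x} e refl .reg↑ q rewrite +-≡ᵇ k q r | reg↑ e q = refl
  setReg-embeds e _ .mem↑ = mem↑ e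

  setMem-embeds : ∀ {ŝ s a i x j y} → Embeds k l ŝ s → j ≡ i → y ≡ x →
    Embeds k l (setMem ŝ a i x) (setMem s (l + a) j y)
  setMem-embeds e _ _ .reg↑ = reg↑ e
  setMem-embeds {a = a} {i} e refl refl .mem↑ b j rewrite +-≡ᵇ l b a | mem↑ e b j = refl

  setReg-sameBelow : ∀ {s r x} → SameBelow k l s (setReg s (k + r) x)
  setReg-sameBelow {s} {r} {x} .reg↓ q q<k = setReg-other s x (<⇒≢ (<-≤-trans q<k (m≤m+n k r)))
  setReg-sameBelow .mem↓ _ _ _ = refl

  setMem-sameBelow : ∀ {s a i x} → SameBelow k l s (setMem s (l + a) i x)
  setMem-sameBelow .reg↓ _ _ = refl
  setMem-sameBelow {a = a} .mem↓ b b<l j rewrite ≢⇒≡ᵇ (<⇒≢ (<-≤-trans b<l (m≤m+n l a))) = refl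

  sameBelow-refl : ∀ {s} → SameBelow k l s s
  sameBelow-refl .reg↓ _ _   = refl
  sameBelow-refl .mem↓ _ _ _ = refl

  sameBelow-trans : ∀ {s s′ s″} → SameBelow k l s s′ → SameBelow k l s′ s″ → SameBelow k l s s″
  sameBelow-trans p q .reg↓ r r<k   = trans (reg↓ q r r<k) (reg↓ p r r<k)
  sameBelow-trans p q .mem↓ a a<l i = trans (mem↓ q a a<l i) (mem↓ p a a<l i)

  open WordRAM

  -- Each step is matched by exactly one shifted step, so the time is unchanged. The word length `w`
  -- is shared by both runs: renaming cannot alter the modulus of the arithmetic.
  offset-run : ∀ {w P ŝ t ŝ′} → Run w P ŝ t ŝ′ → ∀ {s} → Embeds k l ŝ s →
    ∃[ s′ ] (Run w (offset k l P) s t s′ × Embeds k l ŝ′ s′ × SameBelow k l s s′)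
  offset-run run-const e = _ , run-const , setReg-embeds e refl , setReg-sameBelow
  offset-run {w} (run-op {o = o} {p} {q}) e =
    _ , run-op , setReg-embeds e (cong₂ (eval w o) (reg↑ e p) (reg↑ e q)) , setReg-sameBelow
  offset-run {w} (run-load {ŝ} {a = a} {i}) {s} e =
    _ , run-load , setReg-embeds e (trans (cong (mem s (l + a)) (reg↑ e i)) (mem↑ e a (reg ŝ i))) , setReg-sameBelow
  offset-run (run-store {i = i} {r}) e =
    _ , run-store , setMem-embeds e (reg↑ e i) (reg↑ e r) , setMem-sameBelow
  offset-run (run-seq p q) e with offset-run p e
  ... | _ , p′ , e′ , b′ with offset-run q e′
  ... | _ , q′ , e″ , b″ = _ , run-seq p′ q′ , e″ , sameBelow-trans b′ b″
  offset-run (run-then {r} ≢0 p) e with offset-run p e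
  ... | _ , p′ , e′ , b′ = _ , run-then (≢0 ∘ trans (sym (reg↑ e r))) p′ , e′ , b′
  offset-run (run-else {r} ≡0 p) e with offset-run p e
  ... | _ , p′ , e′ , b′ = _ , run-else (trans (reg↑ e r) ≡0) p′ , e′ , b′
  offset-run (run-done {r} ≡0) e = _ , run-done (trans (reg↑ e r) ≡0) , e , sameBelow-refl
  offset-run (run-repeat {r} ≢0 p q) e with offset-run p e
  ... | _ , p′ , e′ , b′ with offset-run q e′
  ... | _ , q′ , e″ , b″ =
    _ , run-repeat (≢0 ∘ trans (sym (reg↑ e r))) p′ q′ , e″ , sameBelow-trans b′ b″

fromBool≤1 : ∀ b → fromBool b ≤ 1
fromBool≤1 false = z≤n
fromBool≤1 true  = s≤s z≤n


-- Compilation of expressions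

data Expr : Set where
  var : Register → Expr
  lit : ℕ → Expr
  bin : Op → Expr → Expr → Expr
  ld  : Array → Expr → Expr
  ite : Expr → Expr → Expr → Expr

-- The temporaries of compiled expressions lie in registers 8,…,31.
Named Temporary : Register → Set
Named r     = T ((r <ᵇ 8) ∨ (31 <ᵇ r))
Temporary d = T ((7 <ᵇ d) ∧ (d <ᵇ 32))

-- For a concrete expression this reduces to a product of unit types, so that its proofs are left as
-- `_` below.
Fits : Register → Expr → Set
Fits d (var r)     = Named r × Temporary d
Fits d (lit x)     = ⊤
Fits d (bin o e f) = Temporary d × Temporary (suc d) × Fits (suc d) e × Fits (2 + d) f
Fits d (ld a e)    = Temporary d × Fits (suc d) e
Fits d (ite e f g) = Temporary d × Fits (suc d) e × Fits (suc d) f × Fits (suc d) g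

-- Temporaries are allotted like a stack: those from `d` upward are free, and an intermediate result
-- in `d` survives because the subexpressions computed after it start higher.
compile : Register → Register → Expr → Program
-- There is no move instruction, so a copy is an addition of zero, which takes a temporary.
compile r d (var q)     = const d 0 ⨾ op r add q d
compile r d (lit x)     = const r x
compile r d (bin o e f) = compile d (suc d) e ⨾ compile (suc d) (2 + d) f ⨾ op r o d (suc d)
compile r d (ld a e)    = compile d (suc d) e ⨾ load r a d
compile r d (ite e f g) = compile d (suc d) e ⨾ ifnz d (compile r (suc d) f) (compile r (suc d) g)

cost : Expr → ℕ
cost (var q)     = 2
cost (lit x)     = 1
cost (bin o e f) = cost e + (cost f + 1)
cost (ld a e)    = cost e + 1
-- Only one branch runs; the sum of both bounds either.
cost (ite e f g) = cost e + (1 + (cost f + cost g))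

-- The arithmetic counterpart of `ite`; written with it, the formulas for the encoding match the
-- compiled expressions.
unless0 : ℕ → ℕ → ℕ → ℕ
unless0 zero    x y = y
unless0 (suc _) x y = x

module Machine (w : ℕ) where

  open WordRAM w hiding (Run)

  M : ℕ
  M = 2 ^ w

  instance
    M≢0 : NonZero M
    M≢0 = m^n≢0 2 w

  word< : ∀ x → word x < M
  word< x = m%n<n x M

  word-small : ∀ {x} → x < M → word x ≡ x
  word-small x<M = m<n⇒m%n≡m x<M

  bitwise< : ∀ f k x y → bitwise f k x y < 2 ^ k
  bitwise< f zero    x y = s≤s z≤n
  bitwise< f (suc k) x y = begin-strict
    fromBool c + 2 * b  ≤⟨ +-monoˡ-≤ (2 * b) (fromBool≤1 c) ⟩
    1 + 2 * b           <⟨ n<1+n _ ⟩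
    2 + 2 * b           ≡⟨ *-suc 2 b ⟨
    2 * suc b           ≤⟨ *-monoʳ-≤ 2 (bitwise< f k (x / 2) (y / 2)) ⟩
    2 * 2 ^ k           ∎
    where
    open ≤-Reasoning
    b = bitwise f k (x / 2) (y / 2)
    c = f (x % 2 ≡ᵇ 1) (y % 2 ≡ᵇ 1)

  eval< : ∀ o x y → eval o x y < M
  eval< add x y       = word< (x + y)
  eval< sub x y       = word< (x + (2 ^ w ∸ y))
  eval< mul x y       = word< (x * y)
  eval< div x zero    = m^n>0 2 w
  eval< div x (suc y) = word< (x / suc y)
  eval< rem x zero    = m^n>0 2 w
  eval< rem x (suc y) = word< (x % suc y)
  eval< and x y       = bitwise< _∧_ w x y
  eval< or  x y       = bitwise< _∨_ w x y
  eval< xor x y       = bitwise< _xor_ w x y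
  eval< shl x y       = word< (x * 2 ^ y)
  eval< shr x y       = word< ((x / 2 ^ y) {{m^n≢0 2 y}})
  eval< lt  x y       = word< (fromBool (x <ᵇ y))
  eval< eq  x y       = word< (fromBool (x ≡ᵇ y))

  -- Copying adds zero modulo `M`, so it is faithful only on values that already are words. Every
  -- run preserves this, even one of an unknown program.
  record Words (s : State) : Set where
    field
      reg< : ∀ r → reg s r < M
      mem< : ∀ a i → mem s a i < M
  open Words public

  setReg-words : ∀ {s r x} → Words s → x < M → Words (setReg s r x)
  setReg-words {r = r} ws x<M .reg< q with q ≡ᵇ r
  ... | true  = x<M
  ... | false = reg< ws q
  setReg-words ws x<M .mem< = mem< ws

  setMem-words : ∀ {s a i x} → Words s → x < M → Words (setMem s a i x)
  setMem-words ws x<M .reg< = reg< ws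
  setMem-words {a = a} {i} ws x<M .mem< b j with (b ≡ᵇ a) ∧ (j ≡ᵇ i)
  ... | true  = x<M
  ... | false = mem< ws b j

  run-words : ∀ {P s t s′} → Run w P s t s′ → Words s → Words s′
  run-words run-const            ws = setReg-words ws (word< _)
  run-words (run-op {o = o})     ws = setReg-words ws (eval< o _ _)
  run-words (run-load {a = a})   ws = setReg-words ws (mem< ws a _)
  run-words (run-store {r = r})  ws = setMem-words ws (reg< ws r)
  run-words (run-seq p q)        ws = run-words q (run-words p ws)
  run-words (run-then _ p)       ws = run-words p ws
  run-words (run-else _ p)       ws = run-words p ws
  run-words (run-done _)         ws = ws
  run-words (run-repeat _ p q)   ws = run-words q (run-words p ws)

  ⟦_⟧ : Expr → State → ℕ
  ⟦ var r ⟧     s = reg s r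
  ⟦ lit x ⟧     s = word x
  ⟦ bin o e f ⟧ s = eval o (⟦ e ⟧ s) (⟦ f ⟧ s)
  ⟦ ld a e ⟧    s = mem s a (⟦ e ⟧ s)
  ⟦ ite e f g ⟧ s = unless0 (⟦ e ⟧ s) (⟦ f ⟧ s) (⟦ g ⟧ s)

  Agree : State → State → Set
  Agree s s′ = (∀ r → Named r → reg s′ r ≡ reg s r) × mem s′ ≡ mem s

  -- Named registers are never temporaries, so a subexpression keeps its value while the earlier
  -- ones are computed.
  ⟦⟧-agree : ∀ {d s s′} e → Fits d e → Agree s s′ → ⟦ e ⟧ s′ ≡ ⟦ e ⟧ s
  ⟦⟧-agree (var r)     (n , _)         (rs , _)  = rs r n
  ⟦⟧-agree (lit x)     _               _         = refl
  ⟦⟧-agree (bin o e f) (_ , _ , p , q) ag        = cong₂ (eval o) (⟦⟧-agree e p ag) (⟦⟧-agree f q ag)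
  ⟦⟧-agree (ld a e)    (_ , p) ag@(_ , ms)       = cong₂ (λ m i → m a i) ms (⟦⟧-agree e p ag)
  ⟦⟧-agree (ite e f g) (_ , p , q , r) ag
    rewrite ⟦⟧-agree e p ag | ⟦⟧-agree f q ag | ⟦⟧-agree g r ag = refl

  -- Apart from the target `r`, only the temporaries from `d` to 31 may change; registers above 31
  -- are protected because the data structure lives there.
  record Computes (r d : Register) (e : Expr) (s : State) : Set where
    constructor computes
    field
      {time}  : ℕ
      {final} : State
      run     : Run w (compile r d e) s time final
      time≤   : time ≤ cost e
      result  : reg final r ≡ ⟦ e ⟧ s
      frame   : ∀ q → q ≢ r → q < d ⊎ 31 < q → reg final q ≡ reg s q
      frameᵐ  : mem final ≡ mem s
  open Computes

  named-outside : ∀ {d} r → Named r → Temporary d → r < d ⊎ 31 < r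
  named-outside {d} r n t with T-∨ {r <ᵇ 8} .Equivalence.to n
  ... | inj₁ r<8  = inj₁ (≤-trans (<ᵇ⇒< r 8 r<8) (temp≥ d t))
    where
    temp≥ : ∀ d → Temporary d → 8 ≤ d
    temp≥ d t with 7 <ᵇ d in eqn
    ... | true = <ᵇ⇒< 7 d (subst T (sym eqn) tt)
  ... | inj₂ 31<r = inj₂ (<ᵇ⇒< 31 r 31<r)

  temporary≤ : ∀ d → Temporary d → d ≤ 31
  temporary≤ d t with 7 <ᵇ d | d <ᵇ 32 in eqn
  ... | true | true = s≤s⁻¹ (<ᵇ⇒< d 32 (subst T (sym eqn) tt))

  outside-≢ : ∀ {q d e} → Temporary e → d ≤ e → q < d ⊎ 31 < q → q ≢ e
  outside-≢ t d≤e (inj₁ q<d)  = <⇒≢ (<-≤-trans q<d d≤e)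
  outside-≢ {e = e} t d≤e (inj₂ 31<q) = >⇒≢ (≤-<-trans (temporary≤ e t) 31<q)

  widen : ∀ {q d e} → d ≤ e → q < d ⊎ 31 < q → q < e ⊎ 31 < q
  widen d≤e (inj₁ q<d) = inj₁ (<-≤-trans q<d d≤e)
  widen _   (inj₂ h)   = inj₂ h

  agree-after : ∀ {d e s} → Temporary d → (c : Computes d (suc d) e s) → Agree s (final c)
  agree-after {d} t c .proj₁ r n =
    frame c r (outside-≢ t ≤-refl out) (widen (n≤1+n d) out)
    where out = named-outside r n t
  agree-after t c .proj₂ = frameᵐ c

  compute : ∀ e r d s → Words s → Fits d e → Computes r d e s
  compute (var q) r d s ws (n , t) = computes (run-seq run-const run-op) ≤-refl
    (trans (setReg-same s′ r _) value)
    (λ p p≢r out → trans (setReg-other s′ _ p≢r) (setReg-other s _ (outside-≢ t ≤-refl out))) refl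
    where
    s′ = setReg s d (word 0)
    value : eval add (reg s′ q) (reg s′ d) ≡ reg s q
    value rewrite setReg-same s d (word 0)
                | setReg-other s {d} {q} (word 0) (outside-≢ t ≤-refl (named-outside q n t))
                | word-small (m^n>0 2 w) | +-identityʳ (reg s q) = word-small (reg< ws q)
  compute (lit x) r d s ws fits = computes run-const ≤-refl (setReg-same s r _)
    (λ p p≢r _ → setReg-other s _ p≢r) refl
  compute (bin o e f) r d s ws (t , t′ , p , q) =
    computes (run-seq (run c₁) (run-seq (run c₂) run-op))
      (+-mono-≤ (time≤ c₁) (+-monoˡ-≤ 1 (time≤ c₂)))
      (trans (setReg-same (final c₂) r _) (cong₂ (eval o) value₁ value₂))
      (λ y y≢r out → trans (setReg-other (final c₂) _ y≢r)
        (trans (frame c₂ y (outside-≢ t′ (n≤1+n d) out) (widen (m≤n+m d 2) out))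
               (frame c₁ y (outside-≢ t ≤-refl out) (widen (n≤1+n d) out))))
      (trans (frameᵐ c₂) (frameᵐ c₁))
    where
    c₁ = compute e d (suc d) s ws p
    c₂ = compute f (suc d) (2 + d) (final c₁) (run-words (run c₁) ws) q
    value₁ : reg (final c₂) d ≡ ⟦ e ⟧ s
    value₁ = trans (frame c₂ d (<⇒≢ (n<1+n d)) (inj₁ (s≤s (n≤1+n d)))) (result c₁)
    value₂ : reg (final c₂) (suc d) ≡ ⟦ f ⟧ s
    value₂ = trans (result c₂) (⟦⟧-agree f q (agree-after t c₁))
  compute (ld a e) r d s ws (t , p) =
    computes (run-seq (run c₁) run-load) (+-monoˡ-≤ 1 (time≤ c₁))
      (trans (setReg-same (final c₁) r _) (cong₂ (λ m i → m a i) (frameᵐ c₁) (result c₁)))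
      (λ y y≢r out → trans (setReg-other (final c₁) _ y≢r) (frame c₁ y (outside-≢ t ≤-refl out) (widen (n≤1+n d) out)))
      (frameᵐ c₁)
    where c₁ = compute e d (suc d) s ws p
  compute (ite e f g) r d s ws (t , p , q , q′) = branch (⟦ e ⟧ s) refl
    where
    c₁ = compute e d (suc d) s ws p
    c₂ = compute f r (suc d) (final c₁) (run-words (run c₁) ws) q
    c₃ = compute g r (suc d) (final c₁) (run-words (run c₁) ws) q′
    join : ∀ {h} (c : Computes r (suc d) h (final c₁)) → ∀ y → y ≢ r → y < d ⊎ 31 < y → reg (final c) y ≡ reg s y
    join c y y≢r out = trans (frame c y y≢r (widen (n≤1+n d) out)) (frame c₁ y (outside-≢ t ≤-refl out) (widen (n≤1+n d) out))
    branch : ∀ v → ⟦ e ⟧ s ≡ v → Computes r d (ite e f g) s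
    branch zero v≡ = computes (run-seq (run c₁) (run-else (trans (result c₁) v≡) (run c₃)))
      (+-mono-≤ (time≤ c₁) (s≤s (≤-trans (time≤ c₃) (m≤n+m _ (cost f)))))
      (trans (result c₃) (trans (⟦⟧-agree g q′ (agree-after t c₁)) (cong (λ v → unless0 v (⟦ f ⟧ s) (⟦ g ⟧ s)) (sym v≡))))
      (join c₃) (trans (frameᵐ c₃) (frameᵐ c₁))
    branch (suc v) v≡ = computes
      (run-seq (run c₁) (run-then (λ ≡0 → contradiction (trans (sym ≡0) (trans (result c₁) v≡)) λ ()) (run c₂)))
      (+-mono-≤ (time≤ c₁) (s≤s (≤-trans (time≤ c₂) (m≤m+n _ (cost g)))))
      (trans (result c₂) (trans (⟦⟧-agree f q (agree-after t c₁)) (cong (λ v → unless0 v (⟦ f ⟧ s) (⟦ g ⟧ s)) (sym v≡))))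
      (join c₂) (trans (frameᵐ c₂) (frameᵐ c₁))

update : (ℕ → ℕ) → ℕ → ℕ → ℕ → ℕ
update o i x j = if j ≡ᵇ i then x else o j

update-same : ∀ o i x → update o i x i ≡ x
update-same o i x rewrite ≡ᵇ-refl i = refl

update-other : ∀ o {i j} x → j ≢ i → update o i x j ≡ o j
update-other o x j≢i rewrite ≢⇒≡ᵇ j≢i = refl

put : Array → Register → Expr → Program
put a i e = compile 8 9 e ⨾ store a i 8

-- Total correctness with time bounds

module Execution (w : ℕ) (a b : ℕ → ℕ) where

  open Machine w
  open WordRAM w using (eval; word)
  open WordRAM using (run-seq; run-store; run-done; run-repeat)

  -- Time is a constant `C` times a scale `V`: sequencing adds the constants at a fixed scale, and
  -- only loops change the scale.
  record Exec (P : Program) (s : State) (C V : ℕ) (Post : State → Set) : Set where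
    constructor exec
    field
      {time}  : ℕ
      {final} : State
      run     : Run w P s time final
      time≤   : time ≤ C * V
      words   : Words final
      post    : Post final

  weaken : ∀ {P s C V Q R} → Exec P s C V Q → (∀ {s′} → Q s′ → R s′) → Exec P s C V R
  weaken (exec r t ws q) f = exec r t ws (f q)

  infixl 1 _then_

  _then_ : ∀ {P P′ s C C′ V Q R} → Exec P s C V Q → (∀ {s′} → Words s′ → Q s′ → Exec P′ s′ C′ V R) →
           Exec (P ⨾ P′) s (C + C′) V R
  _then_ {C = C} {C′} {V} (exec r t ws q) f with f ws q
  ... | exec r′ t′ ws′ q′ = exec (run-seq r r′)
    (≤-trans (+-mono-≤ t t′) (≤-reflexive (sym (*-distribʳ-+ V C C′)))) ws′ q′

  -- `Inv` is indexed by the number of rounds still to come, which yields termination. The 2 pays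
  -- for the tests: one in each round, and the final one.
  loop : ∀ {r P C V m} .{{_ : NonZero V}} .{{_ : NonZero m}} (Inv : ℕ → State → Set) →
         (∀ {s} → Inv 0 s → reg s r ≡ 0) → (∀ {k s} → Inv (suc k) s → reg s r ≢ 0) →
         (∀ {k s} → Words s → Inv (suc k) s → Exec P s C V (Inv k)) →
         ∀ {k s} → k ≤ m → Words s → Inv k s → Exec (while r P) s (2 + C) (m * V) (Inv 0)
  loop {r} {P} {C} {V} {m} Inv stop go body {k} k≤m ws inv with iterate k ws inv
    where
    iterate : ∀ k {s} → Words s → Inv k s → Exec (while r P) s (1 + k * (1 + C * V)) 1 (Inv 0)
    iterate zero    ws inv = exec (run-done (stop inv)) (s≤s z≤n) ws inv
    iterate (suc k) ws inv with body ws inv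
    ... | exec r t ws′ inv′ with iterate k ws′ inv′
    ... | exec r′ t′ ws″ inv″ = exec (run-repeat (go inv) r r′)
      (s≤s (≤-trans (+-mono-≤ t t′) (≤-reflexive (trans (cong (C * V +_) (*-identityʳ (1 + k * (1 + C * V))))
        (trans (+-suc (C * V) (k * (1 + C * V))) (sym (*-identityʳ (1 + C * V + k * (1 + C * V))))))))) ws″ inv″
  ... | exec r′ t′ ws′ inv′ = exec r′ (≤-trans t′ bound) ws′ inv′
    where
    open ≤-Reasoning
    bound : (1 + k * (1 + C * V)) * 1 ≤ (2 + C) * (m * V)
    bound = begin
      (1 + k * (1 + C * V)) * 1       ≡⟨ *-identityʳ _ ⟩
      1 + k * (1 + C * V)             ≤⟨ +-mono-≤ (>-nonZero⁻¹ (m * V) {{m*n≢0 m V}}) (*-mono-≤ k≤m (+-monoˡ-≤ (C * V) (>-nonZero⁻¹ V))) ⟩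
      m * V + m * ((1 + C) * V)       ≡⟨ cong (m * V +_) (trans (sym (*-assoc m (1 + C) V)) (trans (cong (_* V) (*-comm m (1 + C))) (*-assoc (1 + C) m V))) ⟩
      (2 + C) * (m * V)               ∎

  ⟦⟧< : ∀ {s} e → Words s → ⟦ e ⟧ s < M
  ⟦⟧< (var r)     ws = reg< ws r
  ⟦⟧< (lit x)     ws = word< x
  ⟦⟧< {s} (bin o e f) ws = eval< o (⟦ e ⟧ s) (⟦ f ⟧ s)
  ⟦⟧< (ld a e)    ws = mem< ws a _
  ⟦⟧< {s} (ite e f g) ws with ⟦ e ⟧ s
  ... | zero  = ⟦⟧< g ws
  ... | suc _ = ⟦⟧< f ws

  infix 4 _⊢_⇓_

  record _⊢_⇓_ (s : State) (e : Expr) (x : ℕ) : Set where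
    constructor evaluates
    field value : ⟦ e ⟧ s ≡ x

  var⇓ : ∀ {s r x} → reg s r ≡ x → s ⊢ var r ⇓ x
  var⇓ = evaluates

  lit⇓ : ∀ {s x} → x < M → s ⊢ lit x ⇓ x
  lit⇓ x<M = evaluates (word-small x<M)

  ld⇓ : ∀ {s c e x y} → s ⊢ e ⇓ x → mem s c x ≡ y → s ⊢ ld c e ⇓ y
  ld⇓ (evaluates refl) eqn = evaluates eqn

  add⇓ : ∀ {s e f x y} → s ⊢ e ⇓ x → s ⊢ f ⇓ y → x + y < M → s ⊢ bin add e f ⇓ x + y
  add⇓ (evaluates refl) (evaluates refl) <M = evaluates (word-small <M)

  mul⇓ : ∀ {s e f x y} → s ⊢ e ⇓ x → s ⊢ f ⇓ y → x * y < M → s ⊢ bin mul e f ⇓ x * y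
  mul⇓ (evaluates refl) (evaluates refl) <M = evaluates (word-small <M)

  -- A branch has to evaluate only if it is taken, since the subtractions inside it are exact only
  -- under its condition.
  ite⇓ : ∀ {s c e f v x y} → s ⊢ c ⇓ v → (0 < v → s ⊢ e ⇓ x) → (v ≡ 0 → s ⊢ f ⇓ y) → s ⊢ ite c e f ⇓ unless0 v x y
  ite⇓ {v = zero}  (evaluates c≡) _ f⇓ with f⇓ refl
  ... | evaluates refl = evaluates (cong (λ v → unless0 v _ _) c≡)
  ite⇓ {v = suc _} (evaluates c≡) e⇓ _ with e⇓ (s≤s z≤n)
  ... | evaluates refl = evaluates (cong (λ v → unless0 v _ _) c≡)

  module _ {s : State} (ws : Words s) where

    sub⇓ : ∀ {e f x y} → s ⊢ e ⇓ x → s ⊢ f ⇓ y → y ≤ x → s ⊢ bin sub e f ⇓ x ∸ y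
    sub⇓ {e} {f} {x} {y} (evaluates refl) (evaluates refl) y≤x = evaluates (begin
      (x + (M ∸ y)) % M ≡⟨ cong (_% M) (+-∸-assoc x {M} {y} (<⇒≤ (⟦⟧< f ws))) ⟨
      (x + M ∸ y) % M   ≡⟨ cong (_% M) (+-∸-comm M y≤x) ⟩
      (x ∸ y + M) % M   ≡⟨ [m+n]%n≡m%n (x ∸ y) M ⟩
      (x ∸ y) % M       ≡⟨ word-small (≤-<-trans (m∸n≤m x y) (⟦⟧< e ws)) ⟩
      x ∸ y             ∎)
      where open ≡-Reasoning

    div⇓ : ∀ {e f x y} .{{_ : NonZero y}} → s ⊢ e ⇓ x → s ⊢ f ⇓ y → s ⊢ bin div e f ⇓ x / y
    div⇓ {e} {x = x} {suc y} (evaluates refl) (evaluates f≡) =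
      evaluates (trans (cong (eval div x) f≡) (word-small (≤-<-trans (m/n≤m x (suc y)) (⟦⟧< e ws))))

    rem⇓ : ∀ {e f x y} .{{_ : NonZero y}} → s ⊢ e ⇓ x → s ⊢ f ⇓ y → s ⊢ bin rem e f ⇓ x % y
    rem⇓ {e} {x = x} {suc y} (evaluates refl) (evaluates f≡) =
      evaluates (trans (cong (eval rem x) f≡) (word-small (≤-<-trans (m%n≤m x (suc y)) (⟦⟧< e ws))))

  lt⇓ : ∀ {s e f x y} → 1 < M → s ⊢ e ⇓ x → s ⊢ f ⇓ y → s ⊢ bin lt e f ⇓ fromBool (x <ᵇ y)
  lt⇓ {x = x} {y} 1<M (evaluates refl) (evaluates refl) = evaluates (word-small (≤-<-trans (fromBool≤1 (x <ᵇ y)) 1<M))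

  eq⇓ : ∀ {s e f x y} → 1 < M → s ⊢ e ⇓ x → s ⊢ f ⇓ y → s ⊢ bin eq e f ⇓ fromBool (x ≡ᵇ y)
  eq⇓ {x = x} {y} 1<M (evaluates refl) (evaluates refl) = evaluates (word-small (≤-<-trans (fromBool≤1 (x ≡ᵇ y)) 1<M))

  -- `a` and `b` are the two input matrices, `o` is the output written so far, and `ŝ` is the state
  -- of the data structure, as seen by its own programs. The temporaries in between are left
  -- unconstrained.
  record Rep (vs : Vec ℕ 8) (o : ℕ → ℕ) (ŝ s : State) : Set where
    field
      named : ∀ r → reg s (toℕ r) ≡ lookup vs r
      arr₀  : ∀ i → mem s 0 i ≡ a i
      arr₁  : ∀ i → mem s 1 i ≡ b i
      arr₂  : ∀ i → mem s 2 i ≡ o i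
      inner : Embeds 32 3 ŝ s
  open Rep public

  module _ {vs o ŝ s} (ws : Words s) (rep : Rep vs o ŝ s) where


    assign : ∀ r e → Fits 8 e → ∀ {x V} .{{_ : NonZero V}} → s ⊢ e ⇓ x →
             Exec (compile (toℕ r) 8 e) s (cost e) V (Rep (vs [ r ]≔ x) o ŝ)
    assign r e fits (evaluates refl) = exec run (≤-trans time≤ (m≤m*n (cost e) _)) (run-words run ws) λ where
        .named q → named′ q (q Finₚ.≟ r)
        .arr₀ i → trans (cong (λ m → m 0 i) frameᵐ) (rep .arr₀ i)
        .arr₁ i → trans (cong (λ m → m 1 i) frameᵐ) (rep .arr₁ i)
        .arr₂ i → trans (cong (λ m → m 2 i) frameᵐ) (rep .arr₂ i)
        .inner .Embeds.reg↑ q → trans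
          (frame (32 + q) (>⇒≢ (<-≤-trans (Finₚ.toℕ<n r) (m≤m+n 8 (24 + q)))) (inj₂ (m≤m+n 32 q)))
          (rep .inner .Embeds.reg↑ q)
        .inner .Embeds.mem↑ c i → trans (cong (λ m → m (3 + c) i) frameᵐ) (rep .inner .Embeds.mem↑ c i)
      where
      open Computes (compute e (toℕ r) 8 s ws fits)
      named′ : ∀ q → _ → reg final (toℕ q) ≡ lookup (vs [ r ]≔ ⟦ e ⟧ s) q
      named′ q (yes refl) = trans result (sym (lookup∘updateAt r vs))
      named′ q (no q≢r)   = trans (frame (toℕ q) (q≢r ∘ Finₚ.toℕ-injective) (inj₁ (Finₚ.toℕ<n q)))
        (trans (rep .named q) (sym (lookup∘updateAt′ q r q≢r vs)))

    assign↑ : ∀ r e → Fits 8 e → ∀ {x V} .{{_ : NonZero V}} → s ⊢ e ⇓ x →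
              Exec (compile (32 + r) 8 e) s (cost e) V (Rep vs o (setReg ŝ r x))
    assign↑ r e fits (evaluates refl) = exec run (≤-trans time≤ (m≤m*n (cost e) _)) (run-words run ws) λ where
        .named q → trans (frame (toℕ q) (<⇒≢ (<-≤-trans (Finₚ.toℕ<n q) (m≤m+n 8 (24 + r)))) (inj₁ (Finₚ.toℕ<n q)))
                         (rep .named q)
        .arr₀ i → trans (cong (λ m → m 0 i) frameᵐ) (rep .arr₀ i)
        .arr₁ i → trans (cong (λ m → m 1 i) frameᵐ) (rep .arr₁ i)
        .arr₂ i → trans (cong (λ m → m 2 i) frameᵐ) (rep .arr₂ i)
        .inner .Embeds.reg↑ q → inner′ q (q ≟ r)
        .inner .Embeds.mem↑ c i → trans (cong (λ m → m (3 + c) i) frameᵐ) (rep .inner .Embeds.mem↑ c i)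
      where
      open Computes (compute e (32 + r) 8 s ws fits)
      inner′ : ∀ q → _ → reg final (32 + q) ≡ reg (setReg ŝ r (⟦ e ⟧ s)) q
      inner′ q (yes refl) = trans result (sym (setReg-same ŝ r (⟦ e ⟧ s)))
      inner′ q (no q≢r)   = trans (frame (32 + q) (q≢r ∘ +-cancelˡ-≡ 32 q r) (inj₂ (m≤m+n 32 q)))
        (trans (rep .inner .Embeds.reg↑ q) (sym (setReg-other ŝ (⟦ e ⟧ s) q≢r)))

    private
      module Put (e : Expr) (fits : Fits 9 e) where
        open Computes (compute e 8 9 s ws fits) public
        named′ : ∀ q → reg final (toℕ q) ≡ lookup vs q
        named′ q = trans (frame (toℕ q) (<⇒≢ (Finₚ.toℕ<n q)) (inj₁ (m<n⇒m<1+n (Finₚ.toℕ<n q)))) (rep .named q)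
        reg↑′ : ∀ q → reg final (32 + q) ≡ reg ŝ q
        reg↑′ q = trans (frame (32 + q) (>⇒≢ (m≤m+n 9 (23 + q))) (inj₂ (m≤m+n 32 q))) (rep .inner .Embeds.reg↑ q)
        mem′ : ∀ c i → mem final c i ≡ mem s c i
        mem′ c i = cong (λ m → m c i) frameᵐ

    put-output : ∀ r e → Fits 9 e → ∀ {x V} .{{_ : NonZero V}} → s ⊢ e ⇓ x →
                 Exec (put 2 (toℕ r) e) s (cost e + 1) V (Rep vs (update o (lookup vs r) x) ŝ)
    put-output r e fits (evaluates refl) = exec (run-seq run run-store) (≤-trans (+-monoˡ-≤ 1 time≤) (m≤m*n (cost e + 1) _)) (run-words (run-seq run run-store) ws) λ where
        .named → named′
        .arr₀ i → trans (mem′ 0 i) (rep .arr₀ i)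
        .arr₁ i → trans (mem′ 1 i) (rep .arr₁ i)
        .arr₂ i → stored i
        .inner .Embeds.reg↑ → reg↑′
        .inner .Embeds.mem↑ c i → trans (mem′ (3 + c) i) (rep .inner .Embeds.mem↑ c i)
      where
      open Put e fits
      stored : ∀ i → mem (setMem final 2 (reg final (toℕ r)) (reg final 8)) 2 i ≡ update o (lookup vs r) (⟦ e ⟧ s) i
      stored i rewrite named′ r | result | mem′ 2 i | rep .arr₂ i = refl

    put-inner : ∀ c r e → Fits 9 e → ∀ {x V} .{{_ : NonZero V}} → s ⊢ e ⇓ x →
                Exec (put (3 + c) (toℕ r) e) s (cost e + 1) V (Rep vs o (setMem ŝ c (lookup vs r) x))
    put-inner c r e fits (evaluates refl) = exec (run-seq run run-store) (≤-trans (+-monoˡ-≤ 1 time≤) (m≤m*n (cost e + 1) _)) (run-words (run-seq run run-store) ws) λ where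
        .named → named′
        .arr₀ i → trans (mem′ 0 i) (rep .arr₀ i)
        .arr₁ i → trans (mem′ 1 i) (rep .arr₁ i)
        .arr₂ i → trans (mem′ 2 i) (rep .arr₂ i)
        .inner → setMem-embeds {ŝ = ŝ} embeds (named′ r) result
      where
      open Put e fits
      embeds : Embeds 32 3 ŝ final
      embeds .Embeds.reg↑ = reg↑′
      embeds .Embeds.mem↑ d i = trans (mem′ (3 + d) i) (rep .inner .Embeds.mem↑ d i)

    call : ∀ {P t ŝ′ C V} → Run w P ŝ t ŝ′ → t ≤ C * V → Exec (offset 32 3 P) s C V (Rep vs o ŝ′)
    call r t≤ with offset-run r (rep .inner)
    ... | _ , r′ , embeds , below = exec r′ t≤ (run-words r′ ws) λ where
        .named q → trans (SameBelow.reg↓ below (toℕ q) (<-≤-trans (Finₚ.toℕ<n q) (m≤m+n 8 24))) (rep .named q)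
        .arr₀ i → trans (SameBelow.mem↓ below 0 (s≤s z≤n) i) (rep .arr₀ i)
        .arr₁ i → trans (SameBelow.mem↓ below 1 (s≤s (s≤s z≤n)) i) (rep .arr₁ i)
        .arr₂ i → trans (SameBelow.mem↓ below 2 ≤-refl i) (rep .arr₂ i)
        .inner → embeds

-- The grammar

opposite-anti : ∀ {m} (i j : Fin m) → toℕ j < toℕ i → toℕ (opposite i) < toℕ (opposite j)
opposite-anti {m} i j j<i rewrite Finₚ.opposite-prop i | Finₚ.opposite-prop j =
  ∸-monoʳ-< (s≤s j<i) (Finₚ.toℕ<n i)

tabulate-+ : ∀ {A : Set} m {n} (f : Fin (m + n) → A) →
  tabulate f ≡ tabulate (f ∘ (_↑ˡ n)) ++ tabulate (f ∘ (m ↑ʳ_))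
tabulate-+ zero    f = refl
tabulate-+ (suc m) f = cong (f zero ∷_) (tabulate-+ m (f ∘ suc))

tabulate-combine : ∀ {A : Set} m n (f : Fin (m * n) → A) →
  tabulate f ≡ concat (tabulate λ i → tabulate λ j → f (combine {m} {n} i j))
tabulate-combine zero    n f = refl
tabulate-combine (suc m) n f = trans (tabulate-+ n f)
  (cong (tabulate (f ∘ (_↑ˡ m * n)) ++_) (tabulate-combine m n (f ∘ (n ↑ʳ_))))

toList-tabulate : ∀ {A : Set} n (f : Fin n → A) → Vec.toList (Vec.tabulate f) ≡ tabulate f
toList-tabulate zero    f = refl
toList-tabulate (suc n) f = cong (f zero ∷_) (toList-tabulate n (f ∘ suc))

map-concat-tabulate : ∀ {A B : Set} (g : A → B) n (f : Fin n → List A) →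
  map g (concat (tabulate f)) ≡ concat (tabulate (map g ∘ f))
map-concat-tabulate g zero    f = refl
map-concat-tabulate g (suc n) f = trans (map-++ g (f zero) _)
  (cong (map g (f zero) ++_) (map-concat-tabulate g n (f ∘ suc)))

sum-tabulate-const : ∀ n (f : Fin n → ℕ) c → (∀ i → f i ≡ c) → sum (tabulate f) ≡ n * c
sum-tabulate-const zero    f c f≡ = refl
sum-tabulate-const (suc n) f c f≡ = cong₂ _+_ (f≡ zero) (sum-tabulate-const n (f ∘ suc) c (f≡ ∘ suc))

cells-++ˡ : ∀ xs ys {i} → i < length xs → cells (xs ++ ys) i ≡ cells xs i
cells-++ˡ (x ∷ xs) ys {zero}  _         = refl
cells-++ˡ (x ∷ xs) ys {suc i} (s≤s i<l) = cells-++ˡ xs ys i<l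

cells-++ʳ : ∀ xs ys i → cells (xs ++ ys) (length xs + i) ≡ cells ys i
cells-++ʳ []       ys i = refl
cells-++ʳ (x ∷ xs) ys i = cells-++ʳ xs ys i

cells-beyond : ∀ xs {i} → length xs ≤ i → cells xs i ≡ 0
cells-beyond []       _         = refl
cells-beyond (x ∷ xs) (s≤s l≤i) = cells-beyond xs l≤i

cells-tabulate : ∀ {n} (f : Fin n → ℕ) i → cells (tabulate f) (toℕ i) ≡ f i
cells-tabulate f zero    = refl
cells-tabulate f (suc i) = cells-tabulate (f ∘ suc) i

module _ {L : ℕ} where

  length-concat-tabulate : ∀ n (f : Fin n → List ℕ) → (∀ i → length (f i) ≡ L) → length (concat (tabulate f)) ≡ n * L
  length-concat-tabulate zero    f len = refl
  length-concat-tabulate (suc n) f len = trans (length-++ (f zero))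
    (cong₂ _+_ (len zero) (length-concat-tabulate n (f ∘ suc) (len ∘ suc)))

  cells-concat-tabulate : ∀ n (f : Fin n → List ℕ) → (∀ i → length (f i) ≡ L) →
    ∀ u {x} → x < L → cells (concat (tabulate f)) (toℕ u * L + x) ≡ cells (f u) x
  cells-concat-tabulate (suc n) f len zero    x<L = cells-++ˡ (f zero) _ (subst (_ <_) (sym (len zero)) x<L)
  cells-concat-tabulate (suc n) f len (suc u) {x} x<L = begin
    cells (concat (tabulate f)) (L + toℕ u * L + x)                      ≡⟨ cong (cells (concat (tabulate f))) (+-assoc L _ x) ⟩
    cells (concat (tabulate f)) (L + (toℕ u * L + x))                    ≡⟨ cong (λ l → cells (concat (tabulate f)) (l + (toℕ u * L + x))) (len zero) ⟨
    cells (concat (tabulate f)) (length (f zero) + (toℕ u * L + x))      ≡⟨ cells-++ʳ (f zero) _ _ ⟩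
    cells (concat (tabulate (f ∘ suc))) (toℕ u * L + x)                  ≡⟨ cells-concat-tabulate n (f ∘ suc) (len ∘ suc) u x<L ⟩
    cells (f (suc u)) x                                                  ∎
    where open ≡-Reasoning

concatMap-allFin : ∀ {A : Set} {n} (f : Fin n → List A) → concatMap f (allFin n) ≡ concat (tabulate f)
concatMap-allFin f = cong concat (map-tabulate id f)

module Grammar (n c σ : ℕ) (D≤σ : suc n ≤ σ) (a b : ℕ → ℕ) where

  D H : ℕ
  D = suc n
  H = 3 + c

  -- The index n serves as a dummy: a dummy letter, and a dummy row of the second matrix.
  select : (ℕ → ℕ) → Fin D → Fin D → Fin D
  select m i x with m (toℕ i * n + toℕ x)
  ... | zero  = fromℕ n
  ... | suc _ = x

  -- The object i of level h + 1 has the objects child h i x of level h as its parts: level 0 consists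
  -- of the letters, level 1 of the rows of B, level 2 of the rows of A B, levels 3,…,2 + c repeat
  -- these, and every object of level 3 + c is the concatenation of all objects one level below.
  child : ℕ → Fin D → Fin D → Fin D
  child 0             i x = select b i x
  child 1             i x = select a i x
  child (suc (suc t)) i x = if t ≡ᵇ c then x else i

  letter : Fin D → Fin σ
  letter i = inject≤ i D≤σ

  Sym : Set
  Sym = Fin (H * D) ⊎ Fin σ

  -- Letters take up level 0, so the nonterminals of level h + 1 form block h of the numbering.
  object : ∀ h → h ≤ H → Fin D → Sym
  object zero    _   i = inj₂ (letter i)
  object (suc h) h<H i = inj₁ (combine (fromℕ< h<H) i)

  part : Fin H → Fin D → Fin D → Sym
  part t i x = object (toℕ t) (<⇒≤ (Finₚ.toℕ<n t)) (child (toℕ t) i x)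

  level : Fin (H * D) → Fin H
  level = proj₁ ∘ remQuot {H} D

  index : Fin (H * D) → Fin D
  index = proj₂ ∘ remQuot {H} D

  rule : Fin (H * D) → List Sym
  rule A = tabulate (part (level A) (index A))

  node-bound : ∀ h h<H i {B} → object h h<H i ≡ inj₁ B → toℕ B < h * D
  node-bound (suc h) h<H i refl = begin-strict
    toℕ (combine (fromℕ< h<H) i)     ≡⟨ Finₚ.toℕ-combine (fromℕ< h<H) i ⟩
    D * toℕ (fromℕ< h<H) + toℕ i     <⟨ +-monoʳ-< (D * toℕ (fromℕ< h<H)) (Finₚ.toℕ<n i) ⟩
    D * toℕ (fromℕ< h<H) + D         ≡⟨ cong (λ k → D * k + D) (Finₚ.toℕ-fromℕ< h<H) ⟩
    D * h + D                        ≡⟨ +-comm (D * h) D ⟩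
    D + D * h                        ≡⟨ cong (D +_) (*-comm D h) ⟩
    suc h * D                        ∎
    where open ≤-Reasoning

  toℕ-node : ∀ A → toℕ A ≡ toℕ (level A) * D + toℕ (index A)
  toℕ-node A = trans (cong toℕ (sym (Finₚ.combine-remQuot {H} D A)))
    (trans (Finₚ.toℕ-combine (level A) (index A)) (cong (_+ toℕ (index A)) (*-comm D (toℕ (level A)))))

  children-smaller : ∀ A B → inj₁ B ∈ rule A → toℕ B < toℕ A
  children-smaller A B B∈ with ∈-tabulate⁻ B∈
  ... | x , B≡ = <-≤-trans
    (node-bound (toℕ (level A)) (<⇒≤ (Finₚ.toℕ<n (level A))) (child (toℕ (level A)) (index A) x) (sym B≡))
    (≤-trans (m≤m+n _ (toℕ (index A))) (≤-reflexive (sym (toℕ-node A))))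

  G : SLG σ
  G .SLG.nonterminals = H * D
  G .SLG.rhs          = rule
  -- The top rule lists all objects one level below, whatever its index, so index 0 serves; keeping
  -- all D copies keeps the numbering uniform.
  G .SLG.start        = combine (Fin.fromℕ (2 + c)) zero
  -- Parts have smaller numbers than their whole, whereas the ordering wants them later.
  G .SLG.order        = reverse
  G .SLG.acyclic A B B∈ = opposite-anti A B (children-smaller A B B∈)

  open SLG G using (_⇒_; derive; Represents; size)

  size-G : size ≡ H * D * D
  size-G = trans (cong sum (map-tabulate id (λ A → length (rule A) ⊔ 1)))
    (sum-tabulate-const (H * D) _ D λ A → trans (cong (_⊔ 1) (length-tabulate (part (level A) (index A))))
      (m≥n⇒m⊔n≡m {D} (s≤s z≤n)))

  infix 4 _⇒*_

  _⇒*_ : List Sym → List Sym → Set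
  _⇒*_ = Star _⇒_

  context : ∀ α {γ δ} β → γ ⇒* δ → α ++ γ ++ β ⇒* α ++ δ ++ β
  context α β = gmap (λ γ → α ++ γ ++ β) step
    where
    step : ∀ {γ δ} → γ ⇒ δ → (α ++ γ ++ β) ⇒ (α ++ δ ++ β)
    step (derive μ A ν) = subst₂ _⇒_ (assoc (inj₁ A ∷ ν)) (assoc′ (rule A)) (derive (α ++ μ) A (ν ++ β))
      where
      assoc : ∀ κ → (α ++ μ) ++ κ ++ β ≡ α ++ (μ ++ κ) ++ β
      assoc κ = trans (++-assoc α μ (κ ++ β)) (cong (α ++_) (sym (++-assoc μ κ β)))
      assoc′ : ∀ κ → (α ++ μ) ++ κ ++ ν ++ β ≡ α ++ (μ ++ κ ++ ν) ++ β
      assoc′ κ = trans (cong ((α ++ μ) ++_) (sym (++-assoc κ ν β))) (assoc (κ ++ ν))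

  derives-each : ∀ m (f : Fin m → Sym) (g : Fin m → List Sym) → (∀ x → f x ∷ [] ⇒* g x) →
                 tabulate f ⇒* concat (tabulate g)
  derives-each zero    f g d = ε
  derives-each (suc m) f g d = context [] (tabulate (f ∘ suc)) (d zero) ◅◅
    subst₂ _⇒*_ (cong (g zero ++_) (++-identityʳ (tabulate (f ∘ suc))))
                (cong (g zero ++_) (++-identityʳ (concat (tabulate (g ∘ suc)))))
      (context (g zero) [] (derives-each m (f ∘ suc) (g ∘ suc) (d ∘ suc)))

  -- A position is read as `h` digits in base D: the leading digit chooses the part, the others the
  -- place inside it.
  letterAt : ∀ h → Fin D → Fin (D ^ h) → Fin D
  letterAt zero    i p = i
  letterAt (suc h) i p = let (x , p′) = remQuot {D} (D ^ h) p in letterAt h (child h i x) p′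

  letterAt-combine : ∀ h i x p → letterAt (suc h) i (combine x p) ≡ letterAt h (child h i x) p
  letterAt-combine h i x p = cong (λ (y , q) → letterAt h (child h i y) q) (Finₚ.remQuot-combine {D} {D ^ h} x p)

  part-cong : ∀ {h h′} → h ≡ h′ → ∀ p p′ i x → object h p (child h i x) ≡ object h′ p′ (child h′ i x)
  part-cong {h} refl p p′ i x = cong (λ q → object h q (child h i x)) (≤-irrelevant p p′)

  rule-combine : ∀ h (h<H : h < H) i → rule (combine (fromℕ< h<H) i) ≡ tabulate (λ x → object h (<⇒≤ h<H) (child h i x))
  rule-combine h h<H i = trans (cong (λ (t , j) → tabulate (part t j)) (Finₚ.remQuot-combine (fromℕ< h<H) i))
    (tabulate-cong (part-cong (Finₚ.toℕ-fromℕ< h<H) (<⇒≤ (Finₚ.toℕ<n (fromℕ< h<H))) (<⇒≤ h<H) i))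

  derives : ∀ h (h≤H : h ≤ H) i → (object h h≤H i ∷ []) ⇒* map inj₂ (tabulate (letter ∘ letterAt h i))
  derives zero    h≤H i = ε
  derives (suc h) h<H i = derive [] (combine (fromℕ< h<H) i) [] ◅
    subst₂ _⇒*_ (sym (trans (++-identityʳ _) (rule-combine h h<H i))) (sym expand)
      (derives-each D _ _ λ x → derives h (<⇒≤ h<H) (child h i x))
    where
    open ≡-Reasoning
    expand : map inj₂ (tabulate (letter ∘ letterAt (suc h) i)) ≡
             concat (tabulate λ x → map inj₂ (tabulate (letter ∘ letterAt h (child h i x))))
    expand = begin
      map inj₂ (tabulate (letter ∘ letterAt (suc h) i))
        ≡⟨ cong (map inj₂) (tabulate-combine D (D ^ h) _) ⟩
      map inj₂ (concat (tabulate {n = D} λ x → tabulate λ p → letter (letterAt (suc h) i (combine x p))))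
        ≡⟨ map-concat-tabulate inj₂ D (λ x → tabulate λ p → letter (letterAt (suc h) i (combine x p))) ⟩
      concat (tabulate {n = D} λ x → map inj₂ (tabulate λ p → letter (letterAt (suc h) i (combine x p))))
        ≡⟨ cong concat (tabulate-cong λ x → cong (map inj₂) (tabulate-cong λ p → cong letter (letterAt-combine h i x p))) ⟩
      concat (tabulate λ x → map inj₂ (tabulate (letter ∘ letterAt h (child h i x)))) ∎

  N : ℕ
  N = D ^ H

  text : Vec.Vec (Fin σ) N
  text = Vec.tabulate (letter ∘ letterAt H zero)

  represents : Represents text
  represents = subst₂ _⇒*_ start≡ (cong (map inj₂) (sym (toList-tabulate N _))) (derives H ≤-refl zero)
    where
    start≡ : object H ≤-refl zero ∷ [] ≡ inj₁ (SLG.start G) ∷ []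
    start≡ = cong (λ t → inj₁ (combine t zero) ∷ []) (Finₚ.toℕ-injective (trans (Finₚ.toℕ-fromℕ< {2 + c} ≤-refl) (sym (Finₚ.toℕ-fromℕ (2 + c)))))

-- Its encoding and its ranks

[m*n+r]/n≡m : ∀ m {r} n .{{_ : NonZero n}} → r < n → (m * n + r) / n ≡ m
[m*n+r]/n≡m m {r} n r<n = trans (+-distrib-/-∣ˡ r (n∣m*n m))
  (trans (cong₂ _+_ (m*n/n≡m m n) (m<n⇒m/n≡0 r<n)) (+-identityʳ m))

[m*n+r]%n≡r : ∀ m {r} n .{{_ : NonZero n}} → r < n → (m * n + r) % n ≡ r
[m*n+r]%n≡r m {r} n r<n = trans (cong (_% n) (+-comm (m * n) r))
  (trans ([m+kn]%n≡m%n r m n) (m<n⇒m%n≡m r<n))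

m≡[m/n]*n+m%n : ∀ m n .{{_ : NonZero n}} → m ≡ m / n * n + m % n
m≡[m/n]*n+m%n m n = trans (m≡m%n+[m/n]*n m n) (+-comm (m % n) _)

cells-map-tabulate : ∀ {A : Set} {n} (g : A → ℕ) (f : Fin n → A) {x} (x<n : x < n) →
  cells (map g (tabulate f)) x ≡ g (f (fromℕ< x<n))
cells-map-tabulate g f {x} x<n = trans (cong₂ cells (map-tabulate f g) (sym (Finₚ.toℕ-fromℕ< x<n))) (cells-tabulate (g ∘ f) (fromℕ< x<n))

-- Sending `r` to the index of `f r` in the filtered list is injective, since the index determines
-- the element.
≤-length-filter : ∀ {m N} {P : Fin N → Set} (P? : Decidable P) (f : Fin m → Fin N) →
  (∀ {r s} → f r ≡ f s → r ≡ s) → (∀ r → P (f r)) → m ≤ length (filter P? (allFin N))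
≤-length-filter {N = N} P? f inj Pf = Finₚ.injective⇒≤ {f = λ r → Any.index (member r)} λ {r} {s} eqn →
  inj (trans (lookup-index (member r)) (trans (cong (List.lookup (filter P? (allFin N))) eqn) (sym (lookup-index (member s)))))
  where
  member : ∀ r → f r ∈ filter P? (allFin N)
  member r = ∈-filter⁺ P? (∈-allFin (f r)) (Pf r)

module Encoding (n c σ : ℕ) (D≤σ : suc n ≤ σ) (a b : ℕ → ℕ) where

  open Grammar n c σ D≤σ a b
  open SLG G using (code; input)

  -- The formulas from here to `entry` transfer `select`, `child` and the coding to natural numbers,
  -- in the shape of the expressions that the program evaluates.
  selectℕ : (ℕ → ℕ) → ℕ → ℕ → ℕ
  selectℕ m i x = unless0 (m (i * n + x)) x n

  childℕ : ℕ → ℕ → ℕ → ℕ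
  childℕ t i x = unless0 (fromBool (t ≡ᵇ 1)) (selectℕ a i x) (unless0 (fromBool (t ≡ᵇ 2 + c)) x i)

  codeℕ : ℕ → ℕ → ℕ → ℕ
  codeℕ t i x = unless0 t (1 + (σ + ((t ∸ 1) * D + childℕ t i x))) (1 + selectℕ b i x)

  -- A right-hand side takes D + 1 cells, its length and then D symbols. So `k / suc D` is the
  -- nonterminal, which D splits into level and index, and the part number is the column minus one.
  entry : ℕ → ℕ
  entry k = unless0 (k % suc D) (codeℕ (k / suc D / D) (k / suc D % D) (k % suc D ∸ 1)) D

  toℕ-select : ∀ m i x → toℕ (select m i x) ≡ selectℕ m (toℕ i) (toℕ x)
  toℕ-select m i x with m (toℕ i * n + toℕ x)
  ... | zero  = Finₚ.toℕ-fromℕ n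
  ... | suc _ = refl

  toℕ-child : ∀ t i x → toℕ (child (suc t) i x) ≡ childℕ (suc t) (toℕ i) (toℕ x)
  toℕ-child zero    i x = toℕ-select a i x
  toℕ-child (suc t) i x with t ≡ᵇ c
  ... | true  = refl
  ... | false = refl

  code-object : ∀ t t≤H i x → code (object t t≤H (child t i x)) ≡ codeℕ t (toℕ i) (toℕ x)
  code-object zero    _   i x = cong suc (trans (Finₚ.toℕ-inject≤ _ D≤σ) (toℕ-select b i x))
  code-object (suc t) t<H i x = cong (λ k → suc (σ + k)) (trans (Finₚ.toℕ-combine (fromℕ< t<H) (child (suc t) i x))
    (cong₂ _+_ (trans (cong (D *_) (Finₚ.toℕ-fromℕ< t<H)) (*-comm D t)) (toℕ-child t i x)))

  row : Fin (H * D) → List ℕ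
  row A = length (rule A) ∷ map code (rule A)

  length-row : ∀ A → length (row A) ≡ suc D
  length-row A = cong suc (trans (length-map code (rule A)) (length-tabulate (part (level A) (index A))))

  level-toℕ : ∀ A → toℕ (level A) ≡ toℕ A / D
  level-toℕ A = sym (trans (cong (_/ D) (toℕ-node A)) ([m*n+r]/n≡m (toℕ (level A)) D (Finₚ.toℕ<n (index A))))

  index-toℕ : ∀ A → toℕ (index A) ≡ toℕ A % D
  index-toℕ A = sym (trans (cong (_% D) (toℕ-node A)) ([m*n+r]%n≡r (toℕ (level A)) D (Finₚ.toℕ<n (index A))))

  cells-row : ∀ A x → x < suc D → cells (row A) x ≡ unless0 x (codeℕ (toℕ A / D) (toℕ A % D) (x ∸ 1)) D
  cells-row A zero    _         = length-tabulate (part (level A) (index A))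
  cells-row A (suc x) (s≤s x<D) = trans (cells-map-tabulate code (part (level A) (index A)) x<D)
    (trans (code-object (toℕ (level A)) _ (index A) (fromℕ< x<D))
      (cong (λ (t , i , y) → codeℕ t i y)
        (cong₂ _,_ (level-toℕ A) (cong₂ _,_ (index-toℕ A) (Finₚ.toℕ-fromℕ< x<D)))))

  total : ℕ
  total = H * D * suc D

  input-entry : ∀ {k} → k < total → mem input 0 k ≡ entry k
  input-entry {k} k<total = begin
    cells (concatMap row (allFin (H * D))) k                      ≡⟨ cong₂ cells (concatMap-allFin row) (m≡[m/n]*n+m%n k (suc D)) ⟩
    cells (concat (tabulate row)) (k / suc D * suc D + k % suc D) ≡⟨ cong (λ q → cells (concat (tabulate row)) (q * suc D + k % suc D)) (Finₚ.toℕ-fromℕ< u<) ⟨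
    cells (concat (tabulate row)) (toℕ u * suc D + k % suc D)     ≡⟨ cells-concat-tabulate (H * D) row length-row u (m%n<n k (suc D)) ⟩
    cells (row u) (k % suc D)                                     ≡⟨ cells-row u (k % suc D) (m%n<n k (suc D)) ⟩
    unless0 (k % suc D) (codeℕ (toℕ u / D) (toℕ u % D) (k % suc D ∸ 1)) D
      ≡⟨ cong (λ q → unless0 (k % suc D) (codeℕ (q / D) (q % D) (k % suc D ∸ 1)) D) (Finₚ.toℕ-fromℕ< u<) ⟩
    entry k ∎
    where
    open ≡-Reasoning
    u< : k / suc D < H * D
    u< = m<n*o⇒m/o<n k<total
    u = fromℕ< u<

  input-beyond : ∀ {k} → total ≤ k → mem input 0 k ≡ 0
  input-beyond total≤k = cells-beyond _ (≤-trans
    (≤-reflexive (trans (cong length (concatMap-allFin row)) (length-concat-tabulate (H * D) row length-row))) total≤k)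

  repeat-child : ∀ {t} → t < c → ∀ i x → child (2 + t) i x ≡ i
  repeat-child t<c i x rewrite ≢⇒≡ᵇ (<⇒≢ t<c) = refl

  top-child : ∀ i x → child (2 + c) i x ≡ x
  top-child i x rewrite ≡ᵇ-refl c = refl

  -- The repeating levels hand the index down unchanged, so every position ends in the same two
  -- selections.
  letterAt-select : ∀ t → t ≤ c → ∀ i p → ∃[ k ] ∃[ x ] (letterAt (2 + t) i p ≡ select b (select a i k) x)
  letterAt-select zero    _   i p = _ , _ , refl
  letterAt-select (suc t) t<c i p with letterAt-select t (<⇒≤ t<c) i (proj₂ (remQuot {D} (D ^ (2 + t)) p))
  ... | k , x , eqn = k , x , trans (cong (λ y → letterAt (2 + t) y (proj₂ (remQuot {D} (D ^ (2 + t)) p))) (repeat-child t<c i _)) eqn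

  -- The leading digits `p` number the copy; the last two digits are the place `k` in a row of A and
  -- the place `x` in a row of B.
  occurrence : ∀ t → Fin D → Fin D → Fin (D ^ t) → Fin (D ^ (2 + t))
  occurrence zero    k x p = combine k (combine {m = D} {n = 1} x zero)
  occurrence (suc t) k x p = let (y , p′) = remQuot {D} (D ^ t) p in combine y (occurrence t k x p′)

  letterAt-occurrence : ∀ t → t ≤ c → ∀ i k x p → letterAt (2 + t) i (occurrence t k x p) ≡ select b (select a i k) x
  letterAt-occurrence zero    _   i k x p = trans (letterAt-combine 1 i k (combine {m = D} {n = 1} x zero))
    (letterAt-combine 0 (select a i k) x zero)
  letterAt-occurrence (suc t) t<c i k x p = trans (letterAt-combine (2 + t) i y (occurrence t k x p′))
    (trans (cong (λ z → letterAt (2 + t) z (occurrence t k x p′)) (repeat-child t<c i y))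
      (letterAt-occurrence t (<⇒≤ t<c) i k x p′))
    where
    y = proj₁ (remQuot {D} (D ^ t) p)
    p′ = proj₂ (remQuot {D} (D ^ t) p)

  occurrence-injective : ∀ t {k x p q} → occurrence t k x p ≡ occurrence t k x q → p ≡ q
  occurrence-injective zero    {p = zero} {zero} _ = refl
  occurrence-injective (suc t) {k} {x} {p} {q} same =
    trans (sym (Finₚ.combine-remQuot {D} (D ^ t) p))
      (trans (cong₂ combine (proj₁ parts≡) (occurrence-injective t (proj₂ parts≡))) (Finₚ.combine-remQuot {D} (D ^ t) q))
    where
    y z : Fin D × Fin (D ^ t)
    y = remQuot {D} (D ^ t) p
    z = remQuot {D} (D ^ t) q
    parts≡ : proj₁ y ≡ proj₁ z × occurrence t k x (proj₂ y) ≡ occurrence t k x (proj₂ z)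
    parts≡ = Finₚ.combine-injective (proj₁ y) (occurrence t k x (proj₂ y)) (proj₁ z) (occurrence t k x (proj₂ z)) same

  block : ℕ
  block = D ^ (2 + c)

  letterAt-top : ∀ x p → letterAt H zero (combine x p) ≡ letterAt (2 + c) x p
  letterAt-top x p = trans (letterAt-combine (2 + c) zero x p) (cong (λ y → letterAt (2 + c) y p) (top-child zero x))

  lookup-text : ∀ x p → Vec.lookup text (combine x p) ≡ letter (letterAt (2 + c) x p)
  lookup-text x p = trans (lookup∘tabulate (letter ∘ letterAt H zero) (combine x p)) (cong letter (letterAt-top x p))

  toℕ-position : ∀ (x : Fin D) (p : Fin block) → toℕ (combine x p) ≡ toℕ x * block + toℕ p
  toℕ-position x p = trans (Finₚ.toℕ-combine x p) (cong (_+ toℕ p) (*-comm block (toℕ x)))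

  in-block : ∀ {i x q} → q < block → i * block < suc (x * block + q) → suc (x * block + q) ≤ suc i * block → x ≡ i
  in-block {i} {x} {q} q< lower upper = ≤-antisym
    (s≤s⁻¹ (*-cancelʳ-< _ x (suc i) (≤-<-trans (m≤m+n (x * block) q) upper)))
    (s≤s⁻¹ (*-cancelʳ-< _ i (suc x) (begin-strict
      i * block      ≤⟨ s≤s⁻¹ lower ⟩
      x * block + q  <⟨ +-monoʳ-< (x * block) q< ⟩
      x * block + block ≡⟨ +-comm (x * block) block ⟩
      suc x * block  ∎)))
    where open ≤-Reasoning

  module Query (i j : Fin D) where

    blockRank : ℕ
    blockRank = rank text (toℕ i * block) (suc (toℕ i) * block) (letter j)

    -- One witness `k` gives an occurrence in every copy, and different copies give different
    -- positions.
    rank≥ : ∀ {k} → select b (select a i k) j ≡ j → D ^ c ≤ blockRank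
    rank≥ {k} eqn = ≤-length-filter _ position (λ same → occurrence-injective c (Finₚ.combine-injectiveʳ i _ i _ same)) λ r →
      s≤s (≤-trans (m≤m+n _ _) (≤-reflexive (sym (toℕ-position i (occurrence c k j r))))) ,
      ≤-trans (≤-reflexive (cong suc (toℕ-position i (occurrence c k j r))))
        (≤-trans (+-monoʳ-< (toℕ i * block) (Finₚ.toℕ<n (occurrence c k j r))) (≤-reflexive (+-comm _ block))) ,
      trans (lookup-text i (occurrence c k j r)) (cong letter (trans (letterAt-occurrence c ≤-refl i k j r) eqn))
      where
      position : Fin (D ^ c) → Fin N
      position r = combine i (occurrence c k j r)

    rank≡0 : (∀ k x → select b (select a i k) x ≢ j) → blockRank ≡ 0
    rank≡0 never = cong length (filter-none _ (All.universal absent (allFin N)))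
      where
      absent : ∀ p → ¬ (toℕ i * block < suc (toℕ p) × suc (toℕ p) ≤ suc (toℕ i) * block × Vec.lookup text p ≡ letter j)
      absent p (lower , upper , eqn) with Finₚ.combine-surjective {D} {block} p
      ... | x , q , refl with in-block {toℕ i} {toℕ x} {toℕ q} (Finₚ.toℕ<n q)
                              (subst (λ z → toℕ i * block < suc z) (toℕ-position x q) lower)
                              (subst (λ z → suc z ≤ suc (toℕ i) * block) (toℕ-position x q) upper)
      ... | x≡i with Finₚ.toℕ-injective x≡i
      ... | refl with letterAt-select c ≤-refl i q
      ... | k , y , eqn′ = never k y (trans (sym eqn′) (Finₚ.inject≤-injective D≤σ D≤σ _ _ (trans (sym (lookup-text i q)) eqn)))

open ℝ

-- Real exponents

[m*n]^k≡m^k*n^k : ∀ m n k → (m * n) ^ k ≡ m ^ k * n ^ k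
[m*n]^k≡m^k*n^k m n zero    = refl
[m*n]^k≡m^k*n^k m n (suc k) = trans (cong (m * n *_) ([m*n]^k≡m^k*n^k m n k)) (interchange m n (m ^ k) (n ^ k))

cut-< : ∀ (x : ℝ) {q r} → q <ʳ x → x ʳ< r → q ℚ.< r
cut-< x {q} {r} q<x x<r with ℚₚ.<-cmp q r
... | tri< q<r _ _  = q<r
... | tri≈ _ refl _ = contradiction x<r (disjoint x q<x)
... | tri> _ _ r<q  = contradiction x<r (disjoint x (below-closed x r<q q<x))

-- Denominators are at least 1, so `s` is at most its numerator, which serves as an integer bound
-- for `r`.
numerator-< : ∀ {r s} → 0ℚ ℚ.≤ r → r ℚ.< s → ℤ.∣ ↥ r ∣ ≤ ℤ.∣ ↥ s ∣ * ↧ₙ r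
numerator-< {mkℚ (ℤ.+ p) d _} {mkℚ (ℤ.+ p′) d′ _} _ (*<* ineq) = ≤-trans (m≤m*n p (suc d′))
  (<⇒≤ (ℤₚ.drop‿+<+ (subst₂ ℤ._<_ (sym (ℤₚ.pos-* p (suc d′))) (sym (ℤₚ.pos-* p′ (suc d))) ineq)))
numerator-< {mkℚ (ℤ.+ p) d _} {mkℚ (ℤ.-[1+ p′ ]) d′ _} _ (*<* ineq) =
  contradiction ineq (ℤₚ.≤⇒≯ (ℤₚ.≤-trans ℤ.-≤+ (ℤₚ.≤-reflexive (ℤₚ.pos-* p (suc d′)))))
numerator-< {mkℚ ℤ.-[1+ p ] d _} (*≤* ())

-- Since μ/3 < 1 and κ lies below some rational, κ·N^(μ/3) is at most a constant times N.
alphabet-threshold : ∀ (κ μ : ℝ) → μ ʳ< 1ℚ → ∃[ k ] (∀ {N σ} → 1 ≤ N → k * N ≤ σ → κ ·[ N ^ μ /3 ]≤ σ)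
alphabet-threshold κ μ μ<1 with above-inhabited κ
... | s , κ<s = ℤ.∣ ↥ s ∣ , bound
  where
  e<1 : ∀ e → e <ʳ μ /3 → e ℚ.< 1ℚ
  e<1 e e<μ/3 = ℚₚ.≰⇒> λ 1≤e → ℚₚ.<-irrefl refl (ℚₚ.≤-<-trans
    (ℚₚ.≤-trans (*≤* (+≤+ (s≤s z≤n))) (ℚₚ.*-monoˡ-≤-nonNeg ((ℤ.+ 3) ℚ./ 1) 1≤e)) (cut-< μ e<μ/3 μ<1))
  bound : ∀ {N σ} → 1 ≤ N → ℤ.∣ ↥ s ∣ * N ≤ σ → κ ·[ N ^ μ /3 ]≤ σ
  bound {N} {σ} 1≤N kN≤σ r e 0≤r r<κ 0≤e e<μ/3 = begin
    ℤ.∣ ↥ r ∣ ^ d * N ^ ℤ.∣ ↥ e ∣        ≤⟨ *-mono-≤ (^-monoˡ-≤ d (numerator-< 0≤r (cut-< κ r<κ κ<s)))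
                                              (^-monoʳ-≤ N {{>-nonZero 1≤N}} (≤-trans (numerator-< 0≤e (e<1 e e<μ/3)) (≤-reflexive (*-identityˡ d)))) ⟩
    (k * ↧ₙ r) ^ d * N ^ d               ≡⟨ [m*n]^k≡m^k*n^k (k * ↧ₙ r) N d ⟨
    (k * ↧ₙ r * N) ^ d                   ≡⟨ cong (_^ d) (trans (*-assoc k (↧ₙ r) N) (trans (cong (k *_) (*-comm (↧ₙ r) N)) (sym (*-assoc k N (↧ₙ r))))) ⟩
    (k * N * ↧ₙ r) ^ d                   ≤⟨ ^-monoˡ-≤ d (*-monoˡ-≤ (↧ₙ r) kN≤σ) ⟩
    (σ * ↧ₙ r) ^ d                       ∎
    where
    open ≤-Reasoning
    d = ↧ₙ e
    k = ℤ.∣ ↥ s ∣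

-- Without a greatest element, `P` would climb step by step, up to double negation, beyond its bound
-- `B`.
¬¬-greatest : ∀ {P : ℕ → Set} B → P 0 → (∀ {k} → P k → k ≤ B) → ¬ ¬ (∃[ k ] (P k × ¬ P (suc k)))
¬¬-greatest {P} B P0 bounded none = ¬¬P (suc B) λ p → n≮n B (bounded p)
  where
  ¬¬P : ∀ k → ¬ ¬ P k
  ¬¬P zero    ¬p = ¬p P0
  ¬¬P (suc k) ¬p = ¬¬P k λ p → none (k , p , ¬p)

m≤m^n : ∀ m n .{{_ : NonZero n}} → m ≤ m ^ n
m≤m^n zero    _       = z≤n
m≤m^n (suc m) (suc n) = m≤m*n (suc m) (suc m ^ n) {{m^n≢0 (suc m) n}}

-- A single exponent `e` above `x` bounds all candidates. If no exponent `f` witnessed N^x < K + 1,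
-- then K + 1 would pass every comparison, against the maximality of `K`.
¬¬-floor : ∀ N (x : ℝ) {e} → 0ℚ ℚ.≤ e → x ʳ< e → ¬ ¬ (∃[ K ] (K ≡⌊ N ^ x ⌋))
¬¬-floor N x {e} 0≤e x<e none =
  -- 0 passes every comparison because the denominator is positive; the match on `mkℚ` lets its
  -- power reduce to 0.
  ¬¬-greatest (N ^ ℤ.∣ ↥ e ∣) (λ { (mkℚ _ _ _) _ _ → z≤n })
    (λ {k} k≤ → ≤-trans (m≤m^n k (↧ₙ e)) (k≤ e 0≤e x<e))
    λ (K , K≤ , ¬K+1≤) → ¬K+1≤ λ f 0≤f x<f → ≮⇒≥ λ below → none (K , K≤ , f , 0≤f , x<f , below)

module BelowOne (μ : ℝ) (0<μ : 0ℚ <ʳ μ) where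

  private
    r : ℚ
    r = proj₁ (below-open μ 0<μ)

    0<r : 0ℚ ℚ.< r
    0<r = proj₁ (proj₂ (below-open μ 0<μ))

    r<μ : r <ʳ μ
    r<μ = proj₂ (proj₂ (below-open μ 0<μ))

  -- The denominator of `r` is q + 1, so the exponent e = q/(q + 1) satisfies 1 - e = 1/(q + 1) ≤ r
  -- < μ. What the overview calls q is `suc q` here.
  q : ℕ
  q = ℚ.denominator-1 r

  e : ℚ
  e = mkℚ (ℤ.+ q) q (subst (Coprime.Coprime q) (+-comm q 1) (Coprime.sym (Coprime.coprime-+ (Coprime.1-coprimeTo q))))

  private
    -- Over the common denominator q + 1 the numerators add up to at least 1 + q, since that of `r`
    -- is positive.
    1≤r+e : ∀ r (0<r : 0ℚ ℚ.< r) e → ℚ.denominator-1 e ≡ ℚ.denominator-1 r → ↥ e ≡ ℤ.+ ℚ.denominator-1 r → 1ℚ ℚ.≤ r ℚ.+ e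
    1≤r+e (mkℚ (ℤ.+ suc p) q c) _ (mkℚ _ _ c′) refl refl = ℚₚ.toℚᵘ-cancel-≤
      (ℚᵘₚ.≤-trans (ℚᵘ.*≤* ineq) (ℚᵘₚ.≤-reflexive (ℚᵘₚ.≃-sym (ℚₚ.toℚᵘ-homo-+ (mkℚ (ℤ.+ suc p) q c) (mkℚ (ℤ.+ q) q c′)))))
      where
      ineq : ℤ.+ 1 ℤ.* ℤ.+ (suc q * suc q) ℤ.≤ (ℤ.+ suc p ℤ.* ℤ.+ suc q ℤ.+ ℤ.+ q ℤ.* ℤ.+ suc q) ℤ.* ℤ.+ 1
      ineq = subst₂ ℤ._≤_ (sym (ℤₚ.*-identityˡ (ℤ.+ (suc q * suc q)))) (trans (cong₂ ℤ._+_ (ℤₚ.pos-* (suc p) (suc q)) (ℤₚ.pos-* q (suc q))) (sym (ℤₚ.*-identityʳ (ℤ.+ suc p ℤ.* ℤ.+ suc q ℤ.+ ℤ.+ q ℤ.* ℤ.+ suc q))))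
        (+≤+ (≤-trans (*-monoˡ-≤ (suc q) (s≤s (m≤n+m q p))) (≤-reflexive (*-distribʳ-+ (suc q) (suc p) q))))
    1≤r+e (mkℚ (ℤ.+ zero) q _) (*<* (+<+ ())) _ _ _
    1≤r+e (mkℚ ℤ.-[1+ _ ] q _) (*<* ()) _ _ _

    1-e≤r : 1ℚ ℚ.- e ℚ.≤ r
    1-e≤r = ℚₚ.≤-trans (ℚₚ.+-monoˡ-≤ (ℚ.- e) (1≤r+e r 0<r e refl refl))
      (ℚₚ.≤-reflexive (trans (ℚₚ.+-assoc r e (ℚ.- e)) (trans (cong (r ℚ.+_) (ℚₚ.+-inverseʳ e)) (ℚₚ.+-identityʳ r))))

  0≤e : 0ℚ ℚ.≤ e
  0≤e = *≤* (subst (ℤ._≤ ℤ.+ q ℤ.* ℤ.+ 1) (sym (ℤₚ.*-zeroˡ (ℤ.+ suc q))) (subst (ℤ.+ 0 ℤ.≤_) (sym (ℤₚ.*-identityʳ (ℤ.+ q))) (+≤+ z≤n)))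

  1-μ<e : (1- μ) ʳ< e
  1-μ<e with below-open μ r<μ
  ... | r′ , r<r′ , r′<μ = below-closed μ (ℚₚ.≤-<-trans 1-e≤r r<r′) r′<μ

  -- The exponent 4 + 4q is a multiple of q + 1, so N^e is the integer D^(4q), and the comparison at
  -- the single exponent `e` suffices.
  floor≤ : ∀ D {K} → K ≡⌊ (D ^ (4 + 4 * q)) ^ 1- μ ⌋ → K ≤ D ^ (4 * q)
  floor≤ D {K} (K≤ , _) = ≮⇒≥ λ below → <⇒≱ (^-monoˡ-< (suc q) below) (≤-trans (K≤ e 0≤e 1-μ<e) (≤-reflexive (begin
    (D ^ (4 + 4 * q)) ^ q      ≡⟨ ^-*-assoc D (4 + 4 * q) q ⟩
    D ^ ((4 + 4 * q) * q)      ≡⟨ cong (D ^_) (cong (_* q) (sym (*-suc 4 q))) ⟩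
    D ^ (4 * suc q * q)        ≡⟨ cong (D ^_) (trans (*-assoc 4 (suc q) q) (trans (cong (4 *_) (*-comm (suc q) q)) (sym (*-assoc 4 q (suc q))))) ⟩
    D ^ (4 * q * suc q)        ≡⟨ ^-*-assoc D (4 * q) (suc q) ⟨
    (D ^ (4 * q)) ^ suc q      ∎)))
    where open ≡-Reasoning

-- From an approximate rank to a truth value

approximation-bounds : ∀ {K x y r} → IsAdditiveApproximation K (x ⊖ y) r → r + y < x + K × x < r + K + y
approximation-bounds {K} {x} {y} {r} (lower , upper) =
  ℤₚ.drop‿+<+ (subst₂ ℤ._<_ (lower₁ (ℤ.+ r) (ℤ.+ K) (ℤ.+ y)) (trans (cong (ℤ._+ (ℤ.+ K ℤ.+ ℤ.+ y)) x⊖y) (lower₂ (ℤ.+ x) (ℤ.+ K) (ℤ.+ y)))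
    (ℤₚ.+-monoˡ-< (ℤ.+ K ℤ.+ ℤ.+ y) lower)) ,
  ℤₚ.drop‿+<+ (subst (ℤ._< ℤ.+ r ℤ.+ ℤ.+ K ℤ.+ ℤ.+ y) (trans (cong (ℤ._+ ℤ.+ y) x⊖y) (cancel (ℤ.+ x) (ℤ.+ y)))
    (ℤₚ.+-monoˡ-< (ℤ.+ y) upper))
  where
  x⊖y : x ⊖ y ≡ ℤ.+ x ℤ.- ℤ.+ y
  x⊖y = sym (ℤₚ.m-n≡m⊖n x y)
  lower₁ : ∀ r K y → (r ℤ.- K) ℤ.+ (K ℤ.+ y) ≡ r ℤ.+ y
  lower₁ = solve-∀
  lower₂ : ∀ x K y → (x ℤ.- y) ℤ.+ (K ℤ.+ y) ≡ x ℤ.+ K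
  lower₂ = solve-∀
  cancel : ∀ x y → (x ℤ.- y) ℤ.+ y ≡ x
  cancel = solve-∀

-- The answer x - y may be negative; testing for that first keeps the subtraction exact, on natural
-- numbers as well as on words.
decision : ℕ → ℕ → ℕ → ℕ
decision K x y = unless0 (fromBool (x <ᵇ y)) 0 (unless0 (fromBool (x ∸ y <ᵇ K)) 0 1)

<⇒<ᵇ≡true : ∀ {m n} → m < n → (m <ᵇ n) ≡ true
<⇒<ᵇ≡true m<n = T-≡ .Equivalence.to (<⇒<ᵇ m<n)

≤⇒<ᵇ≡false : ∀ {m n} → n ≤ m → (m <ᵇ n) ≡ false
≤⇒<ᵇ≡false {m} {n} n≤m with m <ᵇ n in eqn
... | false = refl
... | true  = contradiction (<ᵇ⇒< m n (subst T (sym eqn) _)) (≤⇒≯ n≤m)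

decision-large : ∀ {K x y} → y + K ≤ x → decision K x y ≡ 1
decision-large {K} {x} {y} y+K≤x
  rewrite ≤⇒<ᵇ≡false {x} {y} (≤-trans (m≤m+n y K) y+K≤x)
        | ≤⇒<ᵇ≡false {x ∸ y} {K} (m+n≤o⇒m≤o∸n K (≤-trans (≤-reflexive (+-comm K y)) y+K≤x)) = refl

decision-small : ∀ {K x y} → x < y + K → decision K x y ≡ 0
decision-small {K} {x} {y} x<y+K with x <? y
... | yes x<y rewrite <⇒<ᵇ≡true x<y = refl
... | no  x≮y rewrite ≤⇒<ᵇ≡false {x} {y} (≮⇒≥ x≮y)
                    | <⇒<ᵇ≡true {x ∸ y} {K} (subst (x ∸ y <_) (m+n∸m≡n y K) (∸-monoˡ-< x<y+K (≮⇒≥ x≮y))) = refl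

-- Rank 0 gives x - y < K ≤ K′, and a rank of at least 2K′ gives x - y > 2K′ - K ≥ K′. The test
-- involves the upper bound `K′` instead of the true error `K`.
decision-correct : ∀ {K K′ x y r} → K ≤ K′ → IsAdditiveApproximation K (x ⊖ y) r → ∀ b →
  (b ≡ true → K′ + K′ ≤ r) → (b ≡ false → r ≡ 0) → decision K′ x y ≡ fromBool b
decision-correct {K} {K′} {x} {y} {r} K≤K′ approx true large _ = decision-large {K′} {x} {y} (<⇒≤ (+-cancelʳ-< K′ _ _ (begin-strict
    y + K′ + K′    ≡⟨ +-assoc y K′ K′ ⟩
    y + (K′ + K′)  ≤⟨ +-monoʳ-≤ y (large refl) ⟩
    y + r          ≡⟨ +-comm y r ⟩
    r + y          <⟨ proj₁ (approximation-bounds {K} {x} {y} {r} approx) ⟩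
    x + K          ≤⟨ +-monoʳ-≤ x K≤K′ ⟩
    x + K′         ∎)))
  where open ≤-Reasoning
decision-correct {K} {K′} {x} {y} {r} K≤K′ approx false _ small = decision-small {K′} {x} {y} (begin-strict
    x          <⟨ proj₂ (approximation-bounds {K} {x} {y} {r} approx) ⟩
    r + K + y  ≡⟨ cong (λ r → r + K + y) (small refl) ⟩
    K + y      ≤⟨ +-monoˡ-≤ y K≤K′ ⟩
    K′ + y     ≡⟨ +-comm K′ y ⟩
    y + K′     ∎)
  where open ≤-Reasoning

-- Boolean matrices and their products

module _ {n : ℕ} where

  rowMajor-entry : ∀ (M : BoolMatrix n) i j → rowMajor M (toℕ i * n + toℕ j) ≡ fromBool (M i j)
  rowMajor-entry M i j with toℕ i * n + toℕ j <? n * n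
  ... | yes k<n² = cong (fromBool ∘ uncurry M) (trans (cong (remQuot {n} n) (Finₚ.toℕ-injective
        (trans (Finₚ.toℕ-fromℕ< k<n²) (sym position)))) (Finₚ.remQuot-combine i j))
    where
    position : toℕ (combine i j) ≡ toℕ i * n + toℕ j
    position = trans (Finₚ.toℕ-combine i j) (cong (_+ toℕ j) (*-comm n (toℕ i)))
  ... | no k≮n² = contradiction (subst (_< n * n) (trans (Finₚ.toℕ-combine i j) (cong (_+ toℕ j) (*-comm n (toℕ i))))
                    (Finₚ.toℕ<n (combine i j))) k≮n²

  rowMajor-beyond : ∀ (M : BoolMatrix n) {k} → n * n ≤ k → rowMajor M k ≡ 0
  rowMajor-beyond M {k} n²≤k with k <? n * n
  ... | yes k<n² = contradiction n²≤k (<⇒≱ k<n²)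
  ... | no  _    = refl

  rowMajor≤1 : ∀ (M : BoolMatrix n) k → rowMajor M k ≤ 1
  rowMajor≤1 M k with k <? n * n
  ... | yes k<n² = fromBool≤1 _
  ... | no  _    = z≤n

  ⊗-true : ∀ (A B : BoolMatrix n) i j → (A ⊗ B) i j ≡ true → ∃[ k ] (A i k ≡ true × B k j ≡ true)
  ⊗-true A B i j eqn with find (any⁻ (λ k → A i k ∧ B k j) (allFin n) (T-≡ .Equivalence.from eqn))
  ... | k , _ , both with T-∧ {A i k} .Equivalence.to both
  ... | Aik , Bkj = k , T-≡ .Equivalence.to Aik , T-≡ .Equivalence.to Bkj

  true-⊗ : ∀ (A B : BoolMatrix n) i j k → A i k ≡ true → B k j ≡ true → (A ⊗ B) i j ≡ true
  true-⊗ A B i j k Aik Bkj = T-≡ .Equivalence.to (any⁺ (λ k → A i k ∧ B k j) (lose (∈-allFin k)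
    (T-≡ .Equivalence.from (cong₂ _∧_ Aik Bkj))))

module ProductGrammar {n : ℕ} (c σ : ℕ) (D≤σ : suc n ≤ σ) (A B : BoolMatrix n) where

  open Grammar n c σ D≤σ (rowMajor A) (rowMajor B)

  select-true : ∀ (M : BoolMatrix n) i j → M i j ≡ true → select (rowMajor M) (inject₁ i) (inject₁ j) ≡ inject₁ j
  select-true M i j Mij rewrite Finₚ.toℕ-inject₁ i | Finₚ.toℕ-inject₁ j | rowMajor-entry M i j | Mij = refl

  -- Padding can only produce the dummy n, which no `inject₁ j` equals. For i = n the address lies
  -- past the matrix, where `rowMajor` is 0. For x = n it runs over into the next row, but then
  -- `select` returns n on either outcome.
  true-select : ∀ (M : BoolMatrix n) i x j → select (rowMajor M) i x ≡ inject₁ j →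
    x ≡ inject₁ j × ∃[ i′ ] (i ≡ inject₁ i′ × M i′ j ≡ true)
  true-select M i x j selected with rowMajor M (toℕ i * n + toℕ x) in entry
  ... | zero  = contradiction (sym selected) (Finₚ.fromℕ≢inject₁ ∘ sym)
  ... | suc _ with refl ← selected with n ≟ toℕ i
  ... | yes n≡i = contradiction (trans (sym entry) (rowMajor-beyond M
                    (≤-trans (≤-reflexive (cong (_* n) n≡i)) (m≤m+n (toℕ i * n) _)))) λ ()
  ... | no  n≢i = refl , Fin.lower₁ i n≢i , sym (Finₚ.inject₁-lower₁ i n≢i) , holds _ (trans (sym entry′) entry)
    where
    entry′ : rowMajor M (toℕ i * n + toℕ (inject₁ j)) ≡ fromBool (M (Fin.lower₁ i n≢i) j)
    entry′ = trans (cong₂ (λ u v → rowMajor M (u * n + v)) (sym (Finₚ.toℕ-lower₁ i n≢i)) (Finₚ.toℕ-inject₁ j))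
      (rowMajor-entry M _ j)
    holds : ∀ b {k} → fromBool b ≡ suc k → b ≡ true
    holds true _ = refl

  product-selected : ∀ i j → (A ⊗ B) i j ≡ true →
    ∃[ k ] (select (rowMajor B) (select (rowMajor A) (inject₁ i) k) (inject₁ j) ≡ inject₁ j)
  product-selected i j AB≡true with ⊗-true A B i j AB≡true
  ... | k , Aik , Bkj = inject₁ k ,
    trans (cong (λ z → select (rowMajor B) z (inject₁ j)) (select-true A i k Aik)) (select-true B k j Bkj)

  selected-product : ∀ i j k x → select (rowMajor B) (select (rowMajor A) (inject₁ i) k) x ≡ inject₁ j →
    (A ⊗ B) i j ≡ true
  selected-product i j k x selected with true-select B _ x j selected
  ... | _ , k′ , k≡ , Bkj with true-select A _ k k′ k≡
  ... | _ , i′ , i≡ , Aik = true-⊗ A B i j k′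
    (subst (λ i → A i k′ ≡ true) (Finₚ.inject₁-injective (sym i≡)) Aik) Bkj

-- Binary logarithms

⌊m/2⌋<n : ∀ {m n} → m < 2 * n → ⌊ m /2⌋ < n
⌊m/2⌋<n {m} {n} m<2n = ≰⇒> λ n≤ → <⇒≱ m<2n (begin
  2 * n                   ≡⟨ cong (n +_) (+-identityʳ n) ⟩
  n + n                   ≤⟨ +-mono-≤ n≤ (≤-trans n≤ (⌊n/2⌋≤⌈n/2⌉ m)) ⟩
  ⌊ m /2⌋ + ⌈ m /2⌉       ≡⟨ ⌊n/2⌋+⌈n/2⌉≡n m ⟩
  m                       ∎)
  where open ≤-Reasoning

⌊log₂⌋-upper : ∀ k {m} → m < 2 ^ suc k → ⌊log₂ m ⌋ ≤ k
⌊log₂⌋-upper zero    {0}           _ = z≤n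
⌊log₂⌋-upper zero    {1}           _ = z≤n
⌊log₂⌋-upper zero    {suc (suc m)} (s≤s (s≤s ()))
⌊log₂⌋-upper (suc k) {m}           m< = begin
  ⌊log₂ m ⌋                    ≤⟨ m≤n+m∸n ⌊log₂ m ⌋ 1 ⟩
  1 + (⌊log₂ m ⌋ ∸ 1)          ≡⟨ cong suc (⌊log₂⌊n/2⌋⌋≡⌊log₂n⌋∸1 m) ⟨
  1 + ⌊log₂ ⌊ m /2⌋ ⌋          ≤⟨ s≤s (⌊log₂⌋-upper k (⌊m/2⌋<n m<)) ⟩
  suc k                        ∎
  where open ≤-Reasoning

⌊log₂⌋-unique : ∀ {k m} → 2 ^ k ≤ m → m < 2 ^ suc k → ⌊log₂ m ⌋ ≡ k
⌊log₂⌋-unique {k} lower upper = ≤-antisym (⌊log₂⌋-upper k upper)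
  (subst (_≤ _) (⌊log₂[2^n]⌋≡n k) (⌊log₂⌋-mono-≤ lower))

bracket : ∀ m → 1 ≤ m → ∃[ k ] (2 ^ k ≤ m × m < 2 ^ suc k)
bracket 1             _ = 0 , s≤s z≤n , s≤s (s≤s z≤n)
bracket (suc m@(suc _)) _ with bracket m (s≤s z≤n)
... | k , lower , upper with suc m <? 2 ^ suc k
... | yes below = k , m≤n⇒m≤1+n lower , below
... | no ≮    = suc k , ≮⇒≥ ≮ , ≤-<-trans upper (m<n*m (2 ^ suc k) 2 {{m^n≢0 2 (suc k)}} ≤-refl)
  where
  m<n*m : ∀ m n .{{_ : NonZero m}} → 1 < n → m < n * m
  m<n*m m n 1<n = subst (m <_) (*-comm m n) (m<m*n m n 1<n)

⌊log₂⌋-bounds : ∀ m → 1 ≤ m → 2 ^ ⌊log₂ m ⌋ ≤ m × m < 2 ^ suc ⌊log₂ m ⌋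
⌊log₂⌋-bounds m 1≤m with bracket m 1≤m
... | k , lower , upper rewrite ⌊log₂⌋-unique {k} lower upper = lower , upper

-- One round of the program's logarithm loop.
half-bounds : ∀ k {m} → 2 ^ suc k ≤ m → m < 2 ^ suc (suc k) → 2 ^ k ≤ m / 2 × m / 2 < 2 ^ suc k
half-bounds k {m} lower upper =
  ≤-trans (≤-reflexive (sym (trans (cong (_/ 2) (*-comm 2 (2 ^ k))) (m*n/n≡m (2 ^ k) 2)))) (/-monoˡ-≤ 2 lower) ,
  m<n*o⇒m/o<n (subst (m <_) (*-comm 2 (2 ^ suc k)) upper)

m≤2^m : ∀ m → m ≤ 2 ^ m
m≤2^m zero    = z≤n
m≤2^m (suc m) = +-mono-≤ (m^n>0 2 m) (≤-trans (m≤2^m m) (m≤m+n (2 ^ m) 0))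

-- The factor `suc h` instead of `h` absorbs the 1 in the definition of `lg`.
lg-pow : ∀ {m l} h → m ≤ 2 ^ suc l → lg (m ^ h) ≤ suc h * suc l
lg-pow {m} {l} h m≤ = s≤s (begin
  ⌊log₂ m ^ h ⌋               ≤⟨ ⌊log₂⌋-mono-≤ (^-monoˡ-≤ h m≤) ⟩
  ⌊log₂ (2 ^ suc l) ^ h ⌋     ≡⟨ cong ⌊log₂_⌋ (^-*-assoc 2 (suc l) h) ⟩
  ⌊log₂ 2 ^ (suc l * h) ⌋     ≡⟨ ⌊log₂[2^n]⌋≡n (suc l * h) ⟩
  suc l * h                   ≡⟨ *-comm (suc l) h ⟩
  h * suc l                   ≤⟨ m≤n+m (h * suc l) l ⟩
  l + h * suc l               ∎)
  where open ≤-Reasoning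

-- The program

-- The exponent is fixed together with the program, so the product is unrolled and takes constant
-- time.
mulPow : Register → Register → ℕ → Program
-- There is no empty program; copying `r` to itself changes nothing.
mulPow r x zero    = compile r 8 (var r)
mulPow r x (suc k) = compile r 8 (bin mul (var r) (var x)) ⨾ mulPow r x k

mulPowCost : ℕ → ℕ
mulPowCost zero    = 2
mulPowCost (suc k) = 5 + mulPowCost k

-- Registers: 0 holds n, 1 the dimension D = n + 1, 2 the alphabet size, 3 the length of the blocks
-- that are queried, 4 the decision cutoff, 5 the loop counter; 6 and 7 are scratch registers.
module Code (e g′ : ℕ) (construct query : Program) where

  doubling halving : Expr
  doubling = bin add (var 2) (var 2)
  halving  = bin div (var 6) (lit 2)

  blockE totalE : Expr
  blockE = bin mul (var 1) (bin mul (var 1) (bin mul (var 1) (var 4)))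
  totalE = bin mul (bin mul (lit (4 + e)) (var 1)) (bin add (lit 1) (var 1))

  decrement : Expr
  decrement = bin sub (var 5) (lit 1)

  setup : Program
  setup =
    compile 1 8 (bin add (lit 1) (var 0)) ⨾
    compile 6 8 (bin div (var 0) (lit 2)) ⨾
    compile 2 8 (lit 1) ⨾
    -- Register 6 starts at n / 2, so register 2 is doubled exactly l = ⌊log₂ n⌋ times. Register 7
    -- then receives 2^(l+1), whose g′-th power completes the alphabet size.
    while 6 (compile 2 8 doubling ⨾ compile 6 8 halving) ⨾
    compile 7 8 doubling ⨾
    mulPow 2 7 g′ ⨾
    compile 4 8 (lit 1) ⨾
    mulPow 4 1 e ⨾
    compile 3 8 blockE ⨾
    compile 5 8 totalE

  rowE columnE levelE indexE positionE : Expr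
  rowE      = bin div (var 5) (bin add (lit 1) (var 1))
  columnE   = bin rem (var 5) (bin add (lit 1) (var 1))
  levelE    = bin div rowE (var 1)
  indexE    = bin rem rowE (var 1)
  positionE = bin sub columnE (lit 1)

  selectE : Array → Expr
  selectE m = ite (ld m (bin add (bin mul indexE (var 0)) positionE)) positionE (var 0)

  childE nodeE entryE : Expr
  childE = ite (bin eq levelE (lit 1)) (selectE 0) (ite (bin eq levelE (lit (3 + e))) positionE indexE)
  nodeE  = bin add (lit 1) (bin add (var 2) (bin add (bin mul (bin sub levelE (lit 1)) (var 1)) childE))
  entryE = ite columnE (ite levelE nodeE (bin add (lit 1) (selectE 1))) (var 1)

  fill : Program
  fill = while 5 (compile 5 8 decrement ⨾ put 3 5 entryE)

  nonterminalsE startE : Expr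
  nonterminalsE = bin mul (lit (4 + e)) (var 1)
  startE        = bin add (lit 1) (bin add (var 2) (bin mul (var 1) (lit (3 + e))))

  initialise : Program
  initialise = compile 32 8 nonterminalsE ⨾ compile 33 8 (var 2) ⨾ compile 34 8 startE

  lowE highE letterE decisionE : Expr
  lowE      = bin mul (bin div (var 5) (var 0)) (var 3)
  highE     = bin mul (bin add (lit 1) (bin div (var 5) (var 0))) (var 3)
  letterE   = bin add (lit 1) (bin rem (var 5) (var 0))
  decisionE = ite (bin lt (var 32) (var 33)) (lit 0)
                (ite (bin lt (bin sub (var 32) (var 33)) (var 4)) (lit 0) (lit 1))

  askAll : Program
  askAll = while 5 (
    compile 5 8 decrement ⨾
    compile 32 8 lowE ⨾ compile 33 8 highE ⨾ compile 34 8 letterE ⨾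
    offset 32 3 query ⨾
    put 2 5 decisionE)

  main : Program
  main = setup ⨾ fill ⨾ initialise ⨾ offset 32 3 construct ⨾ compile 5 8 (bin mul (var 0) (var 0)) ⨾ askAll

  setupCost fillCost initialiseCost : ℕ
  setupCost = cost (bin add (lit 1) (var 0)) + (cost (bin div (var 0) (lit 2)) + (cost (lit 1) +
    ((2 + (cost doubling + cost halving)) + (cost doubling + (mulPowCost g′ + (cost (lit 1) + (mulPowCost e +
    (cost blockE + cost totalE))))))))
  initialiseCost = cost nonterminalsE + (cost (var 2) + cost startE)
  fillCost = (2 + (cost decrement + (cost entryE + 1))) * (6 * (4 + e))

  mainCost : ℕ → ℕ → ℕ
  mainCost C₁ C₂ = setupCost + (fillCost + (initialiseCost + (C₁ + (cost (bin mul (var 0) (var 0)) +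
    (2 + (cost decrement + (cost lowE + (cost highE + (cost letterE + (C₂ + (cost decisionE + 1)))))))))))

-- Correctness and running time of the program

module Correctness
  (w n e l g′ σ : ℕ) (A B : BoolMatrix n) (1≤n : 1 ≤ n) (2^l≤n : 2 ^ l ≤ n)
  (σ≡ : σ ≡ 2 ^ l * (2 ^ suc l) ^ g′) (D≤σ : suc n ≤ σ)
  -- These two bounds rule out wraparound: the largest values are symbol codes, at most σ plus a
  -- number below σ.
  (small : (5 + e) * suc n ^ (4 + e) < σ) (σ+σ≤M : σ + σ ≤ 2 ^ w)
  -- `V` is the polylogarithmic factor; being larger than `l`, it also pays for the logarithm loop.
  (V : ℕ) (l<V : l < V)
  (construct query : Program)
  where

  open Code e g′ construct query

  a b : ℕ → ℕ
  a = rowMajor A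
  b = rowMajor B

  open Grammar n (suc e) σ D≤σ a b
  open Encoding n (suc e) σ D≤σ a b
  open Execution w a b
  open Machine w using (M; Words; reg<; mem<)
  open SLG G using (input)

  U : ℕ
  U = n * n * V

  instance
    V≢0 : NonZero V
    V≢0 = >-nonZero (≤-trans (s≤s z≤n) l<V)

    n≢0 : NonZero n
    n≢0 = >-nonZero 1≤n

    n*n≢0 : NonZero (n * n)
    n*n≢0 = m*n≢0 n n

    U≢0 : NonZero U
    U≢0 = m*n≢0 (n * n) V

  -- A computable upper bound that replaces the unknown ⌊N^(1-μ)⌋ in the test.
  cutoff : ℕ
  cutoff = D ^ e

  empty : State
  empty = ⟨ (λ _ → 0) , (λ _ _ → 0) ⟩

  σ≤M : σ ≤ M
  σ≤M = ≤-trans (m≤m+n σ σ) σ+σ≤M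

  N≤ : N ≤ (5 + e) * N
  N≤ = m≤n*m N (5 + e)

  fits : ∀ {x} → x ≤ (5 + e) * N → x < M
  fits x≤ = <-≤-trans (≤-<-trans x≤ small) σ≤M

  fitsN : ∀ {x} → x ≤ N → x < M
  fitsN x≤N = fits (≤-trans x≤N N≤)

  pow≤N : ∀ {k} → k ≤ 4 + e → D ^ k ≤ N
  pow≤N = ^-monoʳ-≤ D

  2≤D : 2 ≤ D
  2≤D = s≤s 1≤n

  D≤N : D ≤ N
  D≤N = ≤-trans (≤-reflexive (sym (*-identityʳ D))) (pow≤N {1} (s≤s z≤n))

  D*D≤N : D * D ≤ N
  D*D≤N = ≤-trans (≤-reflexive (cong (D *_) (sym (*-identityʳ D)))) (pow≤N {2} (s≤s (s≤s z≤n)))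

  D*sD≤N : D * suc D ≤ N
  D*sD≤N = ≤-trans (*-monoʳ-≤ D (≤-trans (+-monoˡ-≤ D (s≤s z≤n)) (+-monoʳ-≤ D (m≤n*m D n))))
    (≤-trans (≤-reflexive (cong (λ k → D * (D * k)) (sym (*-identityʳ D)))) (pow≤N {3} (s≤s (s≤s (s≤s z≤n)))))

  total≤ : total ≤ (4 + e) * N
  total≤ = ≤-trans (≤-reflexive (*-assoc H D (suc D))) (*-monoʳ-≤ H D*sD≤N)

  small≤ : ∀ {x} → x ≤ (4 + e) * N → x < M
  small≤ x≤ = fits (≤-trans x≤ (m≤n+m _ N))

  1<M : 1 < M
  1<M = fitsN (≤-trans (s≤s z≤n) D≤N)

  H<M : H < M
  H<M = small≤ (m≤m*n H N {{m^n≢0 D H}})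

  code<M : ∀ {k} → k ≤ H * D → suc (σ + k) < M
  code<M {k} k≤ = ≤-trans (s≤s (≤-reflexive (sym (+-suc σ k)))) (<-≤-trans (+-monoʳ-< σ (≤-<-trans 1+k≤ small)) σ+σ≤M)
    where
    1+k≤ : suc k ≤ (5 + e) * N
    1+k≤ = +-mono-≤ (≤-trans (s≤s z≤n) D≤N) (≤-trans k≤ (*-monoʳ-≤ H D≤N))

  mulPow-correct : ∀ {vs o ŝ s V v y} .{{_ : NonZero V}} (r x : Fin 8) → x ≢ r →
    Fits 8 (bin mul (var (toℕ r)) (var (toℕ x))) → Fits 8 (var (toℕ r)) →
    ∀ k → 1 ≤ y → v * y ^ k < M → lookup vs r ≡ v → lookup vs x ≡ y →
    Words s → Rep vs o ŝ s → Exec (mulPow (toℕ r) (toℕ x) k) s (mulPowCost k) V (Rep (vs [ r ]≔ v * y ^ k) o ŝ)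
  mulPow-correct {vs} {v = v} r x x≢r _ fit zero 1≤y <M vs-r vs-x ws rep =
    assign ws rep r (var (toℕ r)) fit (var⇓ (trans (named rep r) (trans vs-r (sym (*-identityʳ v)))))
  mulPow-correct {vs} {o} {ŝ} {v = v} {y} r x x≢r fit fit′ (suc k) 1≤y <M vs-r vs-x ws rep =
    assign ws rep r (bin mul (var (toℕ r)) (var (toℕ x))) fit
      (mul⇓ (var⇓ (trans (named rep r) vs-r)) (var⇓ (trans (named rep x) vs-x)) (≤-<-trans (m≤m*n (v * y) (y ^ k) {{m^n≢0 y k {{>-nonZero 1≤y}}}}) <M′))
    then λ ws′ rep′ →
    weaken (mulPow-correct r x x≢r fit fit′ k 1≤y <M′ (lookup∘updateAt r vs) (trans (lookup∘updateAt′ x r x≢r vs) vs-x) ws′ rep′)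
      λ {s′} → subst (λ vs → Rep vs o ŝ s′) (trans ([]≔-idempotent vs r) (cong (vs [ r ]≔_) (*-assoc v y (y ^ k))))
    where
    <M′ : v * y * y ^ k < M
    <M′ = ≤-<-trans (≤-reflexive (*-assoc v y (y ^ k))) <M

  zeros : ℕ → ℕ
  zeros _ = 0

  0<M : 0 < M
  0<M = <-trans (s≤s z≤n) 1<M

  matrixInput-words : Words (matrixInput A B)
  matrixInput-words .reg< zero    = fitsN (≤-trans (n≤1+n n) D≤N)
  matrixInput-words .reg< (suc r) = 0<M
  matrixInput-words .mem< 0             i = ≤-<-trans (rowMajor≤1 A i) 1<M
  matrixInput-words .mem< 1             i = ≤-<-trans (rowMajor≤1 B i) 1<M
  matrixInput-words .mem< (suc (suc c)) i = 0<M

  matrixInput-rep : Rep (n ∷ 0 ∷ 0 ∷ 0 ∷ 0 ∷ 0 ∷ 0 ∷ 0 ∷ []) zeros empty (matrixInput A B)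
  matrixInput-rep = λ where
    .named 0F → refl
    .named 1F → refl
    .named 2F → refl
    .named 3F → refl
    .named 4F → refl
    .named 5F → refl
    .named 6F → refl
    .named 7F → refl
    .arr₀ i → refl
    .arr₁ i → refl
    .arr₂ i → refl
    .inner .Embeds.reg↑ r → refl
    .inner .Embeds.mem↑ c i → refl

  vars : ℕ → Vec ℕ 8
  vars k = n ∷ D ∷ σ ∷ block ∷ cutoff ∷ k ∷ 0 ∷ 2 ^ suc l ∷ []

  -- `z` is n after the halvings done so far. Register 6 is one halving ahead, and so vanishes
  -- exactly when no rounds remain.
  record LogInv (k : ℕ) (s : State) : Set where
    field
      {y z} : ℕ
      rep   : Rep (n ∷ D ∷ y ∷ 0 ∷ 0 ∷ 0 ∷ z / 2 ∷ 0 ∷ []) zeros empty s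
      lower : 2 ^ k ≤ z
      upper : z < 2 ^ suc k
      y≡    : y * 2 ^ k ≡ 2 ^ l
  open LogInv

  log-loop : ∀ {s} → Words s → LogInv l s →
    Exec (while 6 (compile 2 8 doubling ⨾ compile 6 8 halving)) s (2 + (cost doubling + cost halving)) U (LogInv 0)
  log-loop {s} ws inv = subst (λ V → Exec (while 6 (compile 2 8 doubling ⨾ compile 6 8 halving)) s (2 + (cost doubling + cost halving)) V (LogInv 0)) (*-identityʳ U)
    (loop LogInv stop go body (≤-trans (<⇒≤ l<V) (m≤n*m V (n * n))) ws inv)
    where
    stop : ∀ {s} → LogInv 0 s → reg s 6 ≡ 0
    stop inv = trans (named (rep inv) 6F) (m<n⇒m/n≡0 (upper inv))
    go : ∀ {k s} → LogInv (suc k) s → reg s 6 ≢ 0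
    go {k} inv ≡0 = contradiction (≤-trans (m^n>0 2 k) (proj₁ (half-bounds k (lower inv) (upper inv))))
      (λ 0<z/2 → <⇒≢ 0<z/2 (sym (trans (sym (named (rep inv) 6F)) ≡0)))
    body : ∀ {k s} → Words s → LogInv (suc k) s →
      Exec (compile 2 8 doubling ⨾ compile 6 8 halving) s (cost doubling + cost halving) 1 (LogInv k)
    body {k} {s} ws inv =
      assign ws (rep inv) 2F doubling _ (add⇓ (var⇓ (named (rep inv) 2F)) (var⇓ (named (rep inv) 2F)) y+y<M)
      then λ ws′ rep′ →
      weaken (assign ws′ rep′ 6F halving _ (div⇓ ws′ (var⇓ (named rep′ 6F)) (lit⇓ (fitsN (≤-trans 2≤D D≤N)))))
      λ rep″ → record
        { rep   = rep″
        ; lower = proj₁ (half-bounds k (lower inv) (upper inv))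
        ; upper = proj₂ (half-bounds k (lower inv) (upper inv))
        ; y≡    = trans (cong (_* 2 ^ k) (sym 2*y)) (trans (*-assoc (y inv) 2 (2 ^ k)) (y≡ inv))
        }
      where
      open ≤-Reasoning
      2*y : y inv * 2 ≡ y inv + y inv
      2*y = trans (*-comm (y inv) 2) (cong (y inv +_) (+-identityʳ (y inv)))
      y+y<M : y inv + y inv < M
      y+y<M = fitsN (begin
        y inv + y inv         ≡⟨ 2*y ⟨
        y inv * 2             ≤⟨ *-monoʳ-≤ (y inv) (m≤m*n 2 (2 ^ k) {{m^n≢0 2 k}}) ⟩
        y inv * 2 ^ suc k     ≡⟨ y≡ inv ⟩
        2 ^ l                 ≤⟨ 2^l≤n ⟩
        n                     ≤⟨ n≤1+n n ⟩
        D                     ≤⟨ D≤N ⟩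
        N                     ∎)

  log-result : ∀ {s} → LogInv 0 s → Rep (n ∷ D ∷ 2 ^ l ∷ 0 ∷ 0 ∷ 0 ∷ 0 ∷ 0 ∷ []) zeros empty s
  log-result {s} inv = subst₂ (λ y z → Rep (n ∷ D ∷ y ∷ 0 ∷ 0 ∷ 0 ∷ z ∷ 0 ∷ []) zeros empty s)
    (trans (sym (*-identityʳ (y inv))) (y≡ inv)) (m<n⇒m/n≡0 (upper inv)) (rep inv)

  setup-correct : n < 2 ^ suc l → Exec setup (matrixInput A B) setupCost U (Rep (vars total) zeros empty)
  setup-correct n<2^1+l =
    assign matrixInput-words matrixInput-rep 1F (bin add (lit 1) (var 0)) _
      (add⇓ (lit⇓ 1<M) (var⇓ refl) (fitsN D≤N)) then λ ws rep →
    assign ws rep 6F (bin div (var 0) (lit 2)) _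
      (div⇓ ws (var⇓ (named rep 0F)) (lit⇓ (fitsN (≤-trans 2≤D D≤N)))) then λ ws rep →
    assign ws rep 2F (lit 1) _ (lit⇓ 1<M) then λ ws rep →
    log-loop ws (record { rep = rep ; lower = 2^l≤n ; upper = n<2^1+l ; y≡ = *-identityˡ (2 ^ l) }) then λ {s} ws inv →
    assign ws (log-result inv) 7F doubling _
      (subst (s ⊢ doubling ⇓_) (cong (2 ^ l +_) (sym (+-identityʳ (2 ^ l))))
        (add⇓ (var⇓ (named (log-result inv) 2F)) (var⇓ (named (log-result inv) 2F)) (fitsN 2^l+2^l≤N))) then λ ws rep →
    mulPow-correct 2F 7F (λ ()) _ _ g′ (m^n>0 2 (suc l)) (subst (_< M) σ≡ σ<M) refl refl ws rep then λ ws rep →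
    assign ws rep 4F (lit 1) _ (lit⇓ 1<M) then λ ws rep →
    mulPow-correct 4F 1F (λ ()) _ _ e (s≤s z≤n) (fitsN (≤-trans (≤-reflexive (*-identityˡ (D ^ e))) (pow≤N (m≤n+m e 4)))) refl refl ws rep
      then λ ws rep →
    assign ws (adjust rep) 3F blockE _ (block⇓ (adjust rep)) then λ ws rep →
    assign ws rep 5F totalE _
      (mul⇓ (mul⇓ (lit⇓ H<M) (var⇓ (named rep 1F)) (small≤ (*-monoʳ-≤ H D≤N)))
            (add⇓ (lit⇓ 1<M) (var⇓ (named rep 1F)) sD<M) (small≤ total≤))
    where
    σ<M : σ < M
    σ<M = <-≤-trans (m<m+n σ (≤-trans (s≤s z≤n) D≤σ)) σ+σ≤M
    2^l+2^l≤N : 2 ^ l + 2 ^ l ≤ N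
    2^l+2^l≤N = ≤-trans (+-mono-≤ (≤-trans 2^l≤n (n≤1+n n)) (≤-trans 2^l≤n (n≤1+n n)))
      (≤-trans (≤-reflexive (cong (D +_) (sym (+-identityʳ D)))) (≤-trans (*-monoˡ-≤ D 2≤D) D*D≤N))
    sD<M : 1 + D < M
    sD<M = fitsN (≤-trans (m≤n*m (suc D) D) D*sD≤N)
    adjust : ∀ {s} → Rep (n ∷ D ∷ 2 ^ l * (2 ^ suc l) ^ g′ ∷ 0 ∷ 1 * D ^ e ∷ 0 ∷ 0 ∷ 2 ^ suc l ∷ []) zeros empty s →
             Rep (n ∷ D ∷ σ ∷ 0 ∷ cutoff ∷ 0 ∷ 0 ∷ 2 ^ suc l ∷ []) zeros empty s
    adjust {s} = subst₂ (λ x y → Rep (n ∷ D ∷ x ∷ 0 ∷ y ∷ 0 ∷ 0 ∷ 2 ^ suc l ∷ []) zeros empty s) (sym σ≡) (*-identityˡ (D ^ e))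
    block⇓ : ∀ {s} → Rep (n ∷ D ∷ σ ∷ 0 ∷ cutoff ∷ 0 ∷ 0 ∷ 2 ^ suc l ∷ []) zeros empty s → s ⊢ blockE ⇓ block
    block⇓ rep = mul⇓ (var⇓ (named rep 1F)) (mul⇓ (var⇓ (named rep 1F)) (mul⇓ (var⇓ (named rep 1F)) (var⇓ (named rep 4F))
      (fitsN (pow≤N (m≤n+m (1 + e) 3)))) (fitsN (pow≤N (m≤n+m (2 + e) 2)))) (fitsN (pow≤N (m≤n+m (3 + e) 1)))

  Rep-cong : ∀ {vs o ŝ ŝ′ s} → (∀ r → reg ŝ r ≡ reg ŝ′ r) → (∀ c i → mem ŝ c i ≡ mem ŝ′ c i) →
    Rep vs o ŝ s → Rep vs o ŝ′ s
  Rep-cong reg≡ mem≡ rep = λ where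
    .named → named rep
    .arr₀  → arr₀ rep
    .arr₁  → arr₁ rep
    .arr₂  → arr₂ rep
    .inner .Embeds.reg↑ r   → trans (inner rep .Embeds.reg↑ r) (reg≡ r)
    .inner .Embeds.mem↑ c i → trans (inner rep .Embeds.mem↑ c i) (mem≡ c i)

  guard : Bool → ℕ → ℕ
  guard c x = if c then 0 else x

  guard-0 : ∀ c → guard c 0 ≡ 0
  guard-0 true  = refl
  guard-0 false = refl

  -- The array is filled downward: cells from `k` on are final, those below are still 0. So
  -- `partial total` is empty, and `partial 0` has the memory of `input`.
  partial : ℕ → State
  partial k = ⟨ (λ _ → 0) , (λ c i → guard (i <ᵇ k) (mem input c i)) ⟩

  partial-total : ∀ c i → 0 ≡ mem (partial total) c i
  partial-total zero i = go (i <? total)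
    where
    go : Dec (i < total) → 0 ≡ guard (i <ᵇ total) (mem input 0 i)
    go (yes i<) = cong (λ c → guard c (mem input 0 i)) (sym (<⇒<ᵇ≡true i<))
    go (no i≮)  = trans (sym (input-beyond {i} (≮⇒≥ i≮))) (cong (λ c → guard c (mem input 0 i)) (sym (≤⇒<ᵇ≡false (≮⇒≥ i≮))))
  partial-total (suc c) i = sym (guard-0 (i <ᵇ total))

  <ᵇ-suc : ∀ {i k} → i ≢ k → (i <ᵇ suc k) ≡ (i <ᵇ k)
  <ᵇ-suc {i} {k} i≢k with i <? k
  ... | yes i<k rewrite <⇒<ᵇ≡true i<k | <⇒<ᵇ≡true (m<n⇒m<1+n i<k) = refl
  ... | no  i≮k rewrite ≤⇒<ᵇ≡false (≮⇒≥ i≮k) | ≤⇒<ᵇ≡false {i} {suc k} (≤∧≢⇒< (≮⇒≥ i≮k) (i≢k ∘ sym)) = refl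

  partial-step : ∀ {k} → k < total → ∀ c i → mem (setMem (partial (suc k)) 0 k (entry k)) c i ≡ mem (partial k) c i
  partial-step {k} k<total zero i = go (i ≟ k)
    where
    x = mem input 0 i
    go : Dec (i ≡ k) → (if i ≡ᵇ k then entry k else guard (i <ᵇ suc k) x) ≡ guard (i <ᵇ k) x
    go (yes refl) = trans (cong (λ c → if c then entry k else guard (i <ᵇ suc k) x) (≡ᵇ-refl k))
      (trans (sym (input-entry k<total)) (cong (λ c → guard c x) (sym (≤⇒<ᵇ≡false {k} {k} ≤-refl))))
    go (no i≢k) = trans (cong (λ c → if c then entry k else guard (i <ᵇ suc k) x) (≢⇒≡ᵇ i≢k))
      (cong (λ c → guard c x) (<ᵇ-suc i≢k))
  partial-step {k} k<total (suc c) i = trans (guard-0 (i <ᵇ suc k)) (sym (guard-0 (i <ᵇ k)))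

  unless0≤ : ∀ v {x y m} → x ≤ m → y ≤ m → unless0 v x y ≤ m
  unless0≤ zero    x≤ y≤ = y≤
  unless0≤ (suc v) x≤ y≤ = x≤

  select⇓ : ∀ {s m f i x} → (∀ j → mem s m j ≡ f j) → s ⊢ indexE ⇓ i → s ⊢ positionE ⇓ x → s ⊢ var 0 ⇓ n →
    i ≤ n → x ≤ n → s ⊢ selectE m ⇓ selectℕ f i x
  select⇓ {i = i} {x} mem≡ index⇓ position⇓ n⇓ i≤n x≤n =
    ite⇓ (ld⇓ (add⇓ (mul⇓ index⇓ n⇓ (≤-<-trans (m≤m+n (i * n) x) i*n+x<M)) position⇓ i*n+x<M) (mem≡ (i * n + x)))
      (λ _ → position⇓) (λ _ → n⇓)
    where
    i*n+x<M : i * n + x < M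
    i*n+x<M = fitsN (≤-trans (+-mono-≤ (*-monoˡ-≤ n i≤n) x≤n) (≤-trans (≤-reflexive (+-comm (n * n) n))
      (≤-trans (*-monoʳ-≤ D (n≤1+n n)) D*D≤N)))

  entry⇓ : ∀ {k o ŝ s} → k < total → Words s → Rep (vars k) o ŝ s → s ⊢ entryE ⇓ entry k
  entry⇓ {k} {o} {ŝ} {s} k<total ws rep =
    ite⇓ column⇓
      (λ 0<col → ite⇓ level⇓ (node⇓ 0<col) λ _ →
        add⇓ (lit⇓ 1<M) (select⇓ (arr₁ rep) index⇓ (position⇓ 0<col) (var⇓ (named rep 0F)) i≤n x≤n)
          (fitsN (≤-trans (s≤s (unless0≤ (b (i * n + x)) x≤n ≤-refl)) D≤N)))
      (λ _ → var⇓ (named rep 1F))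
    where
    u = k / suc D
    col = k % suc D
    t = u / D
    i = u % D
    x = col ∸ 1
    i≤n : i ≤ n
    i≤n = s≤s⁻¹ (m%n<n u D)
    x≤n : x ≤ n
    x≤n = ∸-monoˡ-≤ 1 (s≤s⁻¹ (m%n<n k (suc D)))
    t<H : t < H
    t<H = m<n*o⇒m/o<n (m<n*o⇒m/o<n k<total)
    width⇓ : s ⊢ bin add (lit 1) (var 1) ⇓ suc D
    width⇓ = add⇓ (lit⇓ 1<M) (var⇓ (named rep 1F)) (fitsN (≤-trans (m≤n*m (suc D) D) D*sD≤N))
    row⇓ : s ⊢ rowE ⇓ u
    row⇓ = div⇓ ws (var⇓ (named rep 5F)) width⇓
    column⇓ : s ⊢ columnE ⇓ col
    column⇓ = rem⇓ ws (var⇓ (named rep 5F)) width⇓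
    level⇓ : s ⊢ levelE ⇓ t
    level⇓ = div⇓ ws row⇓ (var⇓ (named rep 1F))
    index⇓ : s ⊢ indexE ⇓ i
    index⇓ = rem⇓ ws row⇓ (var⇓ (named rep 1F))
    position⇓ : 0 < col → s ⊢ positionE ⇓ x
    position⇓ 0<col = sub⇓ ws column⇓ (lit⇓ 1<M) 0<col
    child≤ : childℕ t i x ≤ n
    child≤ = unless0≤ (fromBool (t ≡ᵇ 1)) (unless0≤ (a (i * n + x)) x≤n ≤-refl)
      (unless0≤ (fromBool (t ≡ᵇ 2 + suc e)) x≤n i≤n)
    child⇓ : 0 < col → s ⊢ childE ⇓ childℕ t i x
    child⇓ 0<col = ite⇓ (eq⇓ 1<M level⇓ (lit⇓ 1<M))
      (λ _ → select⇓ (arr₀ rep) index⇓ (position⇓ 0<col) (var⇓ (named rep 0F)) i≤n x≤n)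
      (λ _ → ite⇓ (eq⇓ 1<M level⇓ (lit⇓ (<-trans (n<1+n (3 + e)) H<M))) (λ _ → position⇓ 0<col) (λ _ → index⇓))
    node⇓ : 0 < col → 0 < t → s ⊢ nodeE ⇓ suc (σ + ((t ∸ 1) * D + childℕ t i x))
    node⇓ 0<col 0<t = add⇓ (lit⇓ 1<M) (add⇓ (var⇓ (named rep 2F)) (add⇓ (mul⇓ (sub⇓ ws level⇓ (lit⇓ 1<M) 0<t)
        (var⇓ (named rep 1F)) (≤-<-trans (m≤m+n ((t ∸ 1) * D) _) small′)) (child⇓ 0<col) small′)
        (<-trans (n<1+n _) (code<M node≤))) (code<M node≤)
      where
      node≤ : (t ∸ 1) * D + childℕ t i x ≤ H * D
      node≤ = begin
        (t ∸ 1) * D + childℕ t i x    ≤⟨ +-monoʳ-≤ ((t ∸ 1) * D) (≤-trans child≤ (n≤1+n n)) ⟩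
        (t ∸ 1) * D + D               ≡⟨ +-comm ((t ∸ 1) * D) D ⟩
        suc (t ∸ 1) * D               ≡⟨ cong (_* D) (m+[n∸m]≡n 0<t) ⟩
        t * D                         ≤⟨ *-monoˡ-≤ D (<⇒≤ t<H) ⟩
        H * D                         ∎
        where open ≤-Reasoning
      small′ : (t ∸ 1) * D + childℕ t i x < M
      small′ = small≤ (≤-trans node≤ (*-monoʳ-≤ H D≤N))

  decrement⇓ : ∀ {k o ŝ s} → Words s → Rep (vars (suc k)) o ŝ s → s ⊢ decrement ⇓ k
  decrement⇓ ws rep = sub⇓ ws (var⇓ (named rep 5F)) (lit⇓ 1<M) (s≤s z≤n)

  FillInv : ℕ → State → Set
  FillInv k s = k ≤ total × Rep (vars k) zeros (partial k) s

  -- As n ≥ 1, D ≤ 2n and D + 1 ≤ 3n; hence the 6.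
  total≤U : total ≤ 6 * (4 + e) * U
  total≤U = begin
    H * D * suc D                 ≡⟨ *-assoc H D (suc D) ⟩
    H * (D * suc D)               ≤⟨ *-monoʳ-≤ H (*-mono-≤ D≤2n sD≤3n) ⟩
    H * (2 * n * (3 * n))         ≡⟨ cong (H *_) ([m*n]*[o*p]≡[m*o]*[n*p] 2 n 3 n) ⟩
    H * (6 * (n * n))             ≡⟨ *-assoc H 6 (n * n) ⟨
    H * 6 * (n * n)               ≡⟨ cong (_* (n * n)) (*-comm H 6) ⟩
    6 * H * (n * n)               ≤⟨ *-monoʳ-≤ (6 * H) (m≤m*n (n * n) V) ⟩
    6 * H * U                     ∎
    where
    open ≤-Reasoning
    D≤2n : D ≤ 2 * n
    D≤2n = +-mono-≤ 1≤n (m≤m+n n 0)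
    sD≤3n : suc D ≤ 3 * n
    sD≤3n = +-mono-≤ 1≤n D≤2n

  fill-correct : ∀ {s} → Words s → Rep (vars total) zeros empty s → Exec fill s fillCost U (Rep (vars 0) zeros (partial 0))
  fill-correct {s} ws rep = rescale (weaken (loop {V = 1} {m = 6 * (4 + e) * U} {{_}} {{m*n≢0 (6 * (4 + e)) U}} FillInv
      (λ (_ , rep) → named rep 5F)
      (λ (_ , rep) ≡0 → contradiction (trans (sym ≡0) (named rep 5F)) λ ())
      body total≤U ws (≤-refl , Rep-cong (λ _ → refl) partial-total rep)) proj₂)
    where
    C : ℕ
    C = 2 + (cost decrement + (cost entryE + 1))
    rescale : ∀ {Q} → Exec fill s C (6 * (4 + e) * U * 1) Q → Exec fill s fillCost U Q
    rescale (exec r t ws q) = exec r (≤-trans t (≤-reflexive (trans (cong (C *_) (*-identityʳ (6 * (4 + e) * U)))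
      (sym (*-assoc C (6 * (4 + e)) U))))) ws q
    body : ∀ {k s} → Words s → FillInv (suc k) s →
      Exec (compile 5 8 decrement ⨾ put 3 5 entryE) s (cost decrement + (cost entryE + 1)) 1 (FillInv k)
    body {k} ws (k< , rep) =
      assign ws rep 5F decrement _ (decrement⇓ ws rep) then λ ws rep →
      weaken (put-inner ws rep 0 5F entryE _ (entry⇓ k< ws rep)) λ rep →
      <⇒≤ k< , Rep-cong (λ _ → refl) (partial-step k<) rep

  start≡ : suc (σ + D * (3 + e)) ≡ SLG.code G (inj₁ (SLG.start G))
  start≡ = cong (λ k → suc (σ + k)) (sym (trans (Finₚ.toℕ-combine (fromℕ (3 + e)) (zero {n}))
    (trans (+-identityʳ _) (cong (D *_) (Finₚ.toℕ-fromℕ (3 + e))))))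

  initialise-correct : ∀ {s} → Words s → Rep (vars 0) zeros (partial 0) s →
    Exec initialise s initialiseCost U (Rep (vars 0) zeros input)
  initialise-correct ws rep =
    assign↑ ws rep 0 nonterminalsE _ (mul⇓ (lit⇓ H<M) (var⇓ (named rep 1F)) (small≤ (*-monoʳ-≤ H D≤N))) then λ ws rep →
    assign↑ ws rep 1 (var 2) _ (var⇓ (named rep 2F)) then λ ws rep →
    weaken (assign↑ ws rep 2 startE _
      (add⇓ (lit⇓ 1<M) (add⇓ (var⇓ (named rep 2F)) (mul⇓ (var⇓ (named rep 1F)) (lit⇓ (<-trans (n<1+n (3 + e)) H<M))
        (small≤ (≤-trans start≤ (*-monoʳ-≤ H D≤N)))) (<-trans (n<1+n _) (code<M start≤))) (code<M start≤)))
      (Rep-cong (λ { 0 → refl ; 1 → refl ; 2 → start≡ ; (suc (suc (suc r))) → refl }) λ _ _ → refl)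
    where
    start≤ : D * (3 + e) ≤ H * D
    start≤ = ≤-trans (≤-reflexive (*-comm D (3 + e))) (*-monoˡ-≤ D (n≤1+n (3 + e)))

  decision⇓ : ∀ {vs o ŝ s} → Words s → Rep vs o ŝ s → lookup vs 4F ≡ cutoff →
    s ⊢ decisionE ⇓ decision cutoff (reg ŝ 0) (reg ŝ 1)
  decision⇓ {ŝ = ŝ} {s} ws rep K≡ = ite⇓ (lt⇓ 1<M x⇓ y⇓) (λ _ → lit⇓ 0<M) λ x≮y →
    ite⇓ (lt⇓ 1<M (sub⇓ ws x⇓ y⇓ (≮⇒≥ λ x<y → contradiction (trans (sym (cong fromBool (<⇒<ᵇ≡true x<y))) x≮y) λ ()))
      (var⇓ (trans (named rep 4F) K≡))) (λ _ → lit⇓ 0<M) (λ _ → lit⇓ 1<M)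
    where
    x⇓ : s ⊢ var 32 ⇓ reg ŝ 0
    x⇓ = var⇓ (inner rep .Embeds.reg↑ 0)
    y⇓ : s ⊢ var 33 ⇓ reg ŝ 1
    y⇓ = var⇓ (inner rep .Embeds.reg↑ 1)

  module Queries
    (C₁ C₂ : ℕ) (Floor : ℕ → Set)
    (¬¬floor : ¬ ¬ (∃[ K ] Floor K)) (floor≤ : ∀ {K} → Floor K → K ≤ cutoff)
    (constructs : ∃[ t ] ∃[ s ] (Run w construct input t s × t ≤ C₁ * U))
    (answers : ∀ ŝ → Reachable w construct query G N ŝ → ∀ low high x → low ≤ N → high ≤ N →
      ∃[ t ] ∃[ ŝ′ ] (Run w query (ask ŝ low high x) t ŝ′ × t ≤ C₂ * V ×
        (∀ K → Floor K → IsAdditiveApproximation K (answer ŝ′) (rank text low high x))))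
    where

    open ProductGrammar (suc e) σ D≤σ A B

    product-decision : ∀ i j ŝ → (∀ K → Floor K → IsAdditiveApproximation K (answer ŝ) (Query.blockRank (inject₁ i) (inject₁ j))) →
      decision cutoff (reg ŝ 0) (reg ŝ 1) ≡ fromBool ((A ⊗ B) i j)
    product-decision i j ŝ approximates = decidable-stable (_ ≟ _) λ wrong → ¬¬floor λ (K , floor) →
      wrong (decision-correct {K} {cutoff} {reg ŝ 0} {reg ŝ 1} (floor≤ floor) (approximates K floor) ((A ⊗ B) i j) large zero-rank)
      where
      open Query (inject₁ i) (inject₁ j)
      large : (A ⊗ B) i j ≡ true → cutoff + cutoff ≤ blockRank
      large AB with product-selected i j AB
      -- Here c = e + 1, so the D^c copies number D times `cutoff`, and D ≥ 2.
      ... | k , selected = ≤-trans (≤-reflexive (cong (cutoff +_) (sym (+-identityʳ cutoff))))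
        (≤-trans (*-monoˡ-≤ cutoff 2≤D) (rank≥ {k} selected))
      zero-rank : (A ⊗ B) i j ≡ false → blockRank ≡ 0
      zero-rank AB = rank≡0 λ k x selected → contradiction (trans (sym (selected-product i j k x selected)) AB) λ ()

    -- Queries may alter the structure, so its current state is carried along with its reachability.
    -- Entries are computed downward, hence those from `k` on are done.
    record AskInv (k : ℕ) (s : State) : Set where
      field
        {output} : ℕ → ℕ
        {state}  : State
        k≤       : k ≤ n * n
        rep      : Rep (vars k) output state s
        reached  : Reachable w construct query G N state
        correct  : ∀ j → k ≤ j → j < n * n → output j ≡ rowMajor (A ⊗ B) j
    open AskInv

    ask-step : ∀ {k s} → Words s → AskInv (suc k) s →
      Exec (compile 5 8 decrement ⨾ compile 32 8 lowE ⨾ compile 33 8 highE ⨾ compile 34 8 letterE ⨾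
            offset 32 3 query ⨾ put 2 5 decisionE) s
        (cost decrement + (cost lowE + (cost highE + (cost letterE + (C₂ + (cost decisionE + 1)))))) V (AskInv k)
    ask-step {k} {s} ws inv = step (answers ŝ (reached inv) (toℕ iD * block) (suc (toℕ iD) * block) (letter jD) low≤ high≤)
      where
      ŝ = state inv
      k/n<n : k / n < n
      k/n<n = m<n*o⇒m/o<n (k≤ inv)
      i j : Fin n
      i = fromℕ< k/n<n
      j = fromℕ< (m%n<n k n)
      iD jD : Fin D
      iD = inject₁ i
      jD = inject₁ j
      i≡ : k / n ≡ toℕ iD
      i≡ = sym (trans (Finₚ.toℕ-inject₁ i) (Finₚ.toℕ-fromℕ< k/n<n))
      j≡ : k % n ≡ toℕ j
      j≡ = sym (Finₚ.toℕ-fromℕ< (m%n<n k n))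
      letter≡ : suc (k % n) ≡ suc (toℕ (letter jD))
      letter≡ = cong suc (sym (trans (Finₚ.toℕ-inject≤ jD D≤σ) (trans (Finₚ.toℕ-inject₁ j) (sym j≡))))
      high≤ : suc (toℕ iD) * block ≤ N
      high≤ = *-monoˡ-≤ block (Finₚ.toℕ<n iD)
      low≤ : toℕ iD * block ≤ N
      low≤ = ≤-trans (m≤n+m (toℕ iD * block) block) high≤
      entry≡ : rowMajor (A ⊗ B) k ≡ fromBool ((A ⊗ B) i j)
      entry≡ = trans (cong (rowMajor (A ⊗ B)) (trans (m≡[m/n]*n+m%n k n)
        (cong₂ (λ u v → u * n + v) (trans i≡ (Finₚ.toℕ-inject₁ i)) j≡))) (rowMajor-entry (A ⊗ B) i j)
      row⇓ : ∀ {o ŝ s} → Words s → Rep (vars k) o ŝ s → s ⊢ bin div (var 5) (var 0) ⇓ toℕ iD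
      row⇓ {s = s} ws rep = subst (s ⊢ bin div (var 5) (var 0) ⇓_) i≡ (div⇓ ws (var⇓ (named rep 5F)) (var⇓ (named rep 0F)))
      suc-row<M : suc (toℕ iD) < M
      suc-row<M = fitsN (≤-trans (Finₚ.toℕ<n iD) D≤N)
      updated : ∀ {x} → x ≡ fromBool ((A ⊗ B) i j) → ∀ y → k ≤ y → y < n * n → update (output inv) k x y ≡ rowMajor (A ⊗ B) y
      updated {x} x≡ y k≤y y< = go (y ≟ k)
        where
        go : Dec (y ≡ k) → update (output inv) k x y ≡ rowMajor (A ⊗ B) y
        go (yes refl) = trans (update-same (output inv) k x) (trans x≡ (sym entry≡))
        go (no y≢k)   = trans (update-other (output inv) x y≢k) (correct inv y (≤∧≢⇒< k≤y (y≢k ∘ sym)) y<)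
      step : ∃[ t ] ∃[ ŝ′ ] (Run w query (ask ŝ (toℕ iD * block) (suc (toℕ iD) * block) (letter jD)) t ŝ′ × t ≤ C₂ * V ×
               (∀ K → Floor K → IsAdditiveApproximation K (answer ŝ′) (Query.blockRank iD jD))) → Exec _ s _ V (AskInv k)
      step (t , ŝ′ , run , t≤ , approximates) =
        assign ws (rep inv) 5F decrement _ (decrement⇓ ws (rep inv)) then λ ws rep →
        assign↑ ws rep 0 lowE _ (mul⇓ (row⇓ ws rep) (var⇓ (named rep 3F)) (fitsN low≤)) then λ ws rep →
        assign↑ ws rep 1 highE _ (mul⇓ (add⇓ (lit⇓ 1<M) (row⇓ ws rep) suc-row<M) (var⇓ (named rep 3F)) (fitsN high≤)) then λ ws rep →
        assign↑ ws rep 2 letterE _ (letter⇓ ws rep) then λ ws rep →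
        call ws rep run t≤ then λ ws rep →
        weaken (put-output ws rep 5F decisionE _ (decision⇓ ws rep refl)) λ rep → record
          { k≤      = <⇒≤ (k≤ inv)
          ; rep     = rep
          ; reached = queried (toℕ iD * block) (suc (toℕ iD) * block) (letter jD) low≤ high≤ (reached inv) run
          ; correct = updated (product-decision i j ŝ′ approximates)
          }
        where
        letter⇓ : ∀ {o ŝ s} → Words s → Rep (vars k) o ŝ s → s ⊢ letterE ⇓ suc (toℕ (letter jD))
        letter⇓ {s = s} ws rep = subst (s ⊢ letterE ⇓_) letter≡
          (add⇓ (lit⇓ 1<M) (rem⇓ ws (var⇓ (named rep 5F)) (var⇓ (named rep 0F)))
            (fitsN (≤-trans (s≤s (≤-trans (<⇒≤ (m%n<n k n)) ≤-refl)) D≤N)))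

    main-correct : n < 2 ^ suc l →
      Exec main (matrixInput A B) (mainCost C₁ C₂) U (λ s → ∀ k → k < n * n → mem s 2 k ≡ rowMajor (A ⊗ B) k)
    main-correct n<2^1+l =
      setup-correct n<2^1+l then λ ws rep →
      fill-correct ws rep then λ ws rep →
      initialise-correct ws rep then λ ws rep →
      call ws rep (proj₁ (proj₂ (proj₂ constructs))) (proj₂ (proj₂ (proj₂ constructs))) then λ ws rep →
      assign ws rep 5F (bin mul (var 0) (var 0)) _ (mul⇓ (var⇓ (named rep 0F)) (var⇓ (named rep 0F))
        (fitsN (≤-trans (*-mono-≤ (n≤1+n n) (n≤1+n n)) D*D≤N))) then λ ws rep →
      -- A round costs a multiple of `V`, and there are n·n of them: this is the scale `U`.
      weaken (loop AskInv (λ inv → named (AskInv.rep inv) 5F)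
          (λ inv ≡0 → contradiction (trans (sym ≡0) (named (AskInv.rep inv) 5F)) λ ())
          ask-step ≤-refl ws
          (record { k≤ = ≤-refl ; rep = rep ; reached = constructed (proj₁ (proj₂ (proj₂ constructs)))
                  ; correct = λ j n²≤j j<n² → contradiction j<n² (≤⇒≯ n²≤j) }))
        λ inv k k<n² → trans (arr₂ (AskInv.rep inv) k) (correct inv k z≤n k<n²)

-- Choice of the parameters

module Reduction (μ κ : ℝ) (0<μ : 0ℚ <ʳ μ) (μ<1 : μ ʳ< 1ℚ) (R : ApproximateRankStructure μ κ) where

  open ApproximateRankStructure R
  open BelowOne μ 0<μ using (q; 0≤e; 1-μ<e; floor≤)

  -- `b` is the required ratio of σ to N: `k₀` for the lower bound on the alphabet, 6 + e for
  -- `small`. Of the `g′` factors 2^(l+1) in σ, 4 + e of them dominate N and the other `b` dominate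
  -- the number `b`. The extra 1 in `d` ensures l < V.
  e k₀ b g′ d C₁′ C₂′ : ℕ
  e   = 4 * q
  k₀  = proj₁ (alphabet-threshold κ μ μ<1)
  b   = k₀ + (6 + e)
  g′  = 4 + e + b
  d   = suc (d₁ + d₂)
  C₁′ = C₁ * (4 * (4 + e) * (5 + e) ^ d₁)
  C₂′ = C₂ * (5 + e) ^ d₂

  open Code e g′ construct query using (main; mainCost)

  -- The alphabet is padded so that N + σ + |G| has bit length exactly (1 + g′) lg n: the structure
  -- then runs with the word length of the matrix program.
  module Instance (n : ℕ) (1≤n : 1 ≤ n) (A B : BoolMatrix n) where

    D N l σ w : ℕ
    D = suc n
    N = D ^ (4 + e)
    l = ⌊log₂ n ⌋
    σ = 2 ^ l * (2 ^ suc l) ^ g′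
    w = wordFactor * suc g′ * suc l

    2^l≤n : 2 ^ l ≤ n
    2^l≤n = proj₁ (⌊log₂⌋-bounds n 1≤n)

    n<2^1+l : n < 2 ^ suc l
    n<2^1+l = proj₂ (⌊log₂⌋-bounds n 1≤n)

    instance
      N≢0 : NonZero N
      N≢0 = m^n≢0 D (4 + e)

    1≤N : 1 ≤ N
    1≤N = >-nonZero⁻¹ N

    b*N≤σ : b * N ≤ σ
    b*N≤σ = begin
      b * N                                             ≤⟨ *-mono-≤ (≤-trans (m≤2^m b) (^-monoˡ-≤ b (m≤m*n 2 (2 ^ l) {{m^n≢0 2 l}}))) (^-monoˡ-≤ (4 + e) n<2^1+l) ⟩
      (2 ^ suc l) ^ b * (2 ^ suc l) ^ (4 + e)           ≡⟨ *-comm ((2 ^ suc l) ^ b) _ ⟩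
      (2 ^ suc l) ^ (4 + e) * (2 ^ suc l) ^ b           ≡⟨ ^-distribˡ-+-* (2 ^ suc l) (4 + e) b ⟨
      (2 ^ suc l) ^ g′                                  ≤⟨ m≤n*m ((2 ^ suc l) ^ g′) (2 ^ l) {{m^n≢0 2 l}} ⟩
      σ                                                 ∎
      where open ≤-Reasoning

    small : (5 + e) * N < σ
    small = <-≤-trans (*-monoˡ-< N (n<1+n (5 + e))) (≤-trans (*-monoˡ-≤ N (m≤n+m (6 + e) k₀)) b*N≤σ)

    D≤N : D ≤ N
    D≤N = ≤-trans (≤-reflexive (sym (*-identityʳ D))) (^-monoʳ-≤ D {1} {4 + e} (s≤s z≤n))

    D≤σ : D ≤ σ
    D≤σ = ≤-trans D≤N (≤-trans (m≤n*m N (5 + e)) (<⇒≤ small))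

    σ≡2^ : σ ≡ 2 ^ (l + g′ * suc l)
    σ≡2^ = trans (cong (2 ^ l *_) (trans (^-*-assoc 2 (suc l) g′) (cong (2 ^_) (*-comm (suc l) g′))))
      (sym (^-distribˡ-+-* 2 l (g′ * suc l)))

    σ+σ≡2^ : σ + σ ≡ 2 ^ (suc g′ * suc l)
    σ+σ≡2^ = trans (cong (σ +_) (sym (+-identityʳ σ))) (cong (2 *_) σ≡2^)

    σ+σ≤M : σ + σ ≤ 2 ^ w
    σ+σ≤M = ≤-trans (≤-reflexive σ+σ≡2^) (^-monoʳ-≤ 2 (≤-trans (m≤n*m (suc g′ * suc l) wordFactor {{>-nonZero wordFactor≥1}})
      (≤-reflexive (sym (*-assoc wordFactor (suc g′) (suc l))))))

    open Grammar n (suc e) σ D≤σ (rowMajor A) (rowMajor B) using (G; size-G; text; represents)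

    size≤ : SLG.size G ≤ (4 + e) * N
    size≤ = ≤-trans (≤-reflexive (trans size-G (*-assoc (4 + e) D D))) (*-monoʳ-≤ (4 + e)
      (≤-trans (≤-reflexive (cong (D *_) (sym (*-identityʳ D)))) (^-monoʳ-≤ D {2} {4 + e} (s≤s (s≤s z≤n)))))

    -- As σ is a power of two and N + |G| ≤ (5 + e)·N < σ, the sum lies between σ and 2σ, so its bit
    -- length is that of σ, namely (1 + g′)(l + 1).
    wordLength≡ : wordLength G N ≡ w
    wordLength≡ = trans (cong (λ k → wordFactor * suc k) (⌊log₂⌋-unique {l + g′ * suc l} lower upper))
      (sym (*-assoc wordFactor (suc g′) (suc l)))
      where
      open ≤-Reasoning
      lower : 2 ^ (l + g′ * suc l) ≤ N + σ + SLG.size G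
      lower = ≤-trans (≤-reflexive (sym σ≡2^)) (≤-trans (m≤n+m σ N) (m≤m+n (N + σ) _))
      upper : N + σ + SLG.size G < 2 ^ suc (l + g′ * suc l)
      upper = begin-strict
        N + σ + SLG.size G     ≡⟨ cong (_+ SLG.size G) (+-comm N σ) ⟩
        σ + N + SLG.size G     ≡⟨ +-assoc σ N _ ⟩
        σ + (N + SLG.size G)   ≤⟨ +-monoʳ-≤ σ (+-monoʳ-≤ N size≤) ⟩
        σ + (5 + e) * N        <⟨ +-monoʳ-< σ small ⟩
        σ + σ                  ≡⟨ σ+σ≡2^ ⟩
        2 ^ (suc g′ * suc l)   ∎

    large-alphabet : κ ·[ N ^ μ /3 ]≤ σ
    large-alphabet = proj₂ (alphabet-threshold κ μ μ<1) 1≤N (≤-trans (*-monoˡ-≤ N (m≤m+n k₀ (6 + e))) b*N≤σ)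

    V : ℕ
    V = suc l ^ d

    lgN^≤ : ∀ k → k ≤ d → lg N ^ k ≤ (5 + e) ^ k * V
    lgN^≤ k k≤d = begin
      lg N ^ k                      ≤⟨ ^-monoˡ-≤ k (lg-pow (4 + e) n<2^1+l) ⟩
      ((5 + e) * suc l) ^ k         ≡⟨ [m*n]^k≡m^k*n^k (5 + e) (suc l) k ⟩
      (5 + e) ^ k * suc l ^ k       ≤⟨ *-monoʳ-≤ ((5 + e) ^ k) (^-monoʳ-≤ (suc l) k≤d) ⟩
      (5 + e) ^ k * V               ∎
      where open ≤-Reasoning

    size≤n² : SLG.size G ≤ 4 * (4 + e) * (n * n)
    size≤n² = begin
      SLG.size G                    ≡⟨ trans size-G (*-assoc (4 + e) D D) ⟩
      (4 + e) * (D * D)             ≤⟨ *-monoʳ-≤ (4 + e) (*-mono-≤ D≤2n D≤2n) ⟩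
      (4 + e) * (2 * n * (2 * n))   ≡⟨ cong ((4 + e) *_) ([m*n]*[o*p]≡[m*o]*[n*p] 2 n 2 n) ⟩
      (4 + e) * (4 * (n * n))       ≡⟨ *-assoc (4 + e) 4 (n * n) ⟨
      (4 + e) * 4 * (n * n)         ≡⟨ cong (_* (n * n)) (*-comm (4 + e) 4) ⟩
      4 * (4 + e) * (n * n)         ∎
      where
      open ≤-Reasoning
      D≤2n : D ≤ 2 * n
      D≤2n = +-mono-≤ 1≤n (m≤m+n n 0)

    Constructs : ℕ → ℕ → Set
    Constructs w T = ∃[ t ] ∃[ s ] (Run w construct (SLG.input G) t s × t ≤ T)

    Answers : ℕ → ℕ → Set
    Answers w T = ∀ s → Reachable w construct query G N s → ∀ low high x → low ≤ N → high ≤ N →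
      ∃[ t ] ∃[ s′ ] (Run w query (ask s low high x) t s′ × t ≤ T ×
        (∀ K → K ≡⌊ N ^ 1- μ ⌋ → IsAdditiveApproximation K (answer s′) (rank text low high x)))

    constructs : Constructs w (C₁′ * (n * n * V))
    constructs = relax (subst (λ w → Constructs w (C₁ * (SLG.size G * lg N ^ d₁))) wordLength≡
      (construction G text 1≤N represents large-alphabet))
      where
      open ≤-Reasoning
      bound : C₁ * (SLG.size G * lg N ^ d₁) ≤ C₁′ * (n * n * V)
      bound = begin
        C₁ * (SLG.size G * lg N ^ d₁)                         ≤⟨ *-monoʳ-≤ C₁ (*-mono-≤ size≤n² (lgN^≤ d₁ (m≤n⇒m≤1+n (m≤m+n d₁ d₂)))) ⟩
        C₁ * (4 * (4 + e) * (n * n) * ((5 + e) ^ d₁ * V))     ≡⟨ cong (C₁ *_) ([m*n]*[o*p]≡[m*o]*[n*p] (4 * (4 + e)) (n * n) ((5 + e) ^ d₁) V) ⟩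
        C₁ * (4 * (4 + e) * (5 + e) ^ d₁ * (n * n * V))       ≡⟨ *-assoc C₁ (4 * (4 + e) * (5 + e) ^ d₁) (n * n * V) ⟨
        C₁′ * (n * n * V)                                     ∎
      relax : Constructs w (C₁ * (SLG.size G * lg N ^ d₁)) → Constructs w (C₁′ * (n * n * V))
      relax (t , s , run , t≤) = t , s , run , ≤-trans t≤ bound

    answers : Answers w (C₂′ * V)
    answers s reached low high x low≤ high≤ = relax (subst (λ w → Answers w (C₂ * lg N ^ d₂)) wordLength≡
      (querying G text 1≤N represents large-alphabet) s reached low high x low≤ high≤)
      where
      relax : ∀ {P : ℕ → State → Set} → ∃[ t ] ∃[ s′ ] (Run w query (ask s low high x) t s′ × t ≤ C₂ * lg N ^ d₂ × P t s′) →
              ∃[ t ] ∃[ s′ ] (Run w query (ask s low high x) t s′ × t ≤ C₂′ * V × P t s′)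
      relax (t , s′ , run , t≤ , p) = t , s′ , run ,
        ≤-trans t≤ (≤-trans (*-monoʳ-≤ C₂ (lgN^≤ d₂ (m≤n⇒m≤1+n (m≤n+m d₂ d₁)))) (≤-reflexive (sym (*-assoc C₂ ((5 + e) ^ d₂) V)))) , p

    l<V : l < V
    l<V = ≤-trans (≤-reflexive (sym (*-identityʳ (suc l)))) (^-monoʳ-≤ (suc l) {1} {d} (s≤s z≤n))

    Multiplies : Set
    Multiplies = ∃[ t ] ∃[ s ] (Run w main (matrixInput A B) t s × t ≤ mainCost C₁′ C₂′ * (n ^ 2 * lg n ^ d) ×
      (∀ k → k < n * n → mem s 2 k ≡ rowMajor (A ⊗ B) k))

    multiplies : Multiplies
    multiplies = unpack
      (Correctness.Queries.main-correct w n e l g′ σ A B 1≤n 2^l≤n refl D≤σ small σ+σ≤M V l<V construct query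
        C₁′ C₂′ (λ K → K ≡⌊ N ^ 1- μ ⌋) (¬¬-floor N (1- μ) 0≤e 1-μ<e) (floor≤ D) constructs answers n<2^1+l)
      where
      unpack : Execution.Exec w (rowMajor A) (rowMajor B) main (matrixInput A B) (mainCost C₁′ C₂′) (n * n * V)
                 (λ s → ∀ k → k < n * n → mem s 2 k ≡ rowMajor (A ⊗ B) k) → Multiplies
      unpack (Execution.exec run t≤ _ correct) = _ , _ , run ,
        ≤-trans t≤ (≤-reflexive (cong (λ m → mainCost C₁′ C₂′ * (m * V)) (cong (n *_) (sym (*-identityʳ n))))) , correct

corollary1p6 : (μ κ : ℝ) → 0ℚ <ʳ μ → μ ʳ< 1ℚ → 0ℚ <ʳ κ →
    ApproximateRankStructure μ κ → FastBooleanMatrixProduct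
corollary1p6 μ κ 0<μ μ<1 0<κ R = record
  { program      = main
  ; wordFactor   = ApproximateRankStructure.wordFactor R * suc g′
  ; wordFactor≥1 = *-mono-≤ (ApproximateRankStructure.wordFactor≥1 R) (s≤s z≤n)
  ; C            = mainCost C₁′ C₂′
  ; d            = d
  ; multiplies   = Instance.multiplies
  }
  where
  open Reduction μ κ 0<μ μ<1 R
  open Code e g′ (ApproximateRankStructure.construct R) (ApproximateRankStructure.query R)
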